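{- Let $G$ be a graph with $\Delta(G)=3$ and $\chi'(G)=3$, and let $k<3$. If every partial $3$-edge coloring of at most $k$ edges of $G$ is extendable to a proper $3$-edge coloring of $G$, then every partial $4$-edge coloring of at most $k+1$ edges of $G \square K_2$ is extendable to a proper $4$-edge coloring of $G\square K_2$.
   Context: $G \square H$ denotes the cartesian product; $\Delta(G)$ is the maximum degree and $\chi'(G)$ the chromatic index (a Class 1 graph is one with $\chi'(G)=\Delta(G)$). A partial $t$-edge coloring is a proper edge coloring of some subset of the edges using colors from $\{1,\dots,t\}$; it is extendable if some proper edge coloring with colors $\{1,\dots,t\}$ agrees with it on all colored edges. -}

module Defs where

open import Data.Nat using (ℕ; zero; suc; _+_; _*_; _≤_; _<_)
open import Data.Bool using (Bool; true; false; if_then_else_; _∧_; _∨_; not)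
open import Data.Fin using (Fin; remQuot)
open import Data.Fin.Properties using () renaming (_≟_ to _≟F_)
open import Data.List using (List; length; map; allFin)
open import Data.Nat.ListAction using (sum)
open import Data.List.Membership.Propositional using (_∈_)
open import Data.Maybe using (Maybe; just; nothing)
open import Data.Product using (Σ; ∃; _×_; _,_; proj₁; proj₂)
open import Data.Sum using (_⊎_)
open import Data.Empty using (⊥; ⊥-elim)
open import Relation.Nullary using (¬_; does; yes; no)
open import Relation.Binary.PropositionalEquality using (_≡_; _≢_; refl)
import Relation.Binary.PropositionalEquality as ≡

record Graph (n : ℕ) : Set where
  field
    adj    : Fin n → Fin n → Bool
    sym    : ∀ u v → adj u v ≡ adj v u
    irrefl : ∀ u → adj u u ≡ false
open Graph public

degree : ∀ {n} → Graph n → Fin n → ℕ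
degree G u = sum (map (λ v → if adj G u v then 1 else 0) (allFin _))

MaxDegree : ∀ {n} → Graph n → ℕ → Set
MaxDegree G d = (∀ u → degree G u ≤ d) × (∃ λ u → degree G u ≡ d)

-- A proper t-edge colouring: every edge uv gets a colour in Fin t
-- (values on non-edges are irrelevant), consistently in both directions,
-- and two distinct edges sharing a vertex get distinct colours.
record ProperEdgeColoring {n} (G : Graph n) (t : ℕ) : Set where
  field
    col    : Fin n → Fin n → Fin t
    symm   : ∀ u v → adj G u v ≡ true → col u v ≡ col v u
    proper : ∀ u v w → adj G u v ≡ true → adj G u w ≡ true → v ≢ w →
             col u v ≢ col u w
open ProperEdgeColoring public

ChromaticIndex : ∀ {n} → Graph n → ℕ → Set
ChromaticIndex G t =
  ProperEdgeColoring G t × (∀ s → s < t → ¬ ProperEdgeColoring G s)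

record PartialEdgeColoring {n} (G : Graph n) (t : ℕ) : Set where
  field
    pcol    : Fin n → Fin n → Maybe (Fin t)
    onEdges : ∀ u v c → pcol u v ≡ just c → adj G u v ≡ true
    psymm   : ∀ u v → pcol u v ≡ pcol v u
    pproper : ∀ u v w c → v ≢ w → pcol u v ≡ just c → pcol u w ≡ just c → ⊥
open PartialEdgeColoring public

ColorsAtMost : ∀ {n} {G : Graph n} {t} → PartialEdgeColoring G t → ℕ → Set
ColorsAtMost {n} p k =
  Σ (List (Fin n × Fin n)) λ L → length L ≤ k ×
    (∀ u v c → pcol p u v ≡ just c → (u , v) ∈ L ⊎ (v , u) ∈ L)

Extendable : ∀ {n} {G : Graph n} {t} → PartialEdgeColoring G t → Set
Extendable {G = G} {t} p =
  Σ (ProperEdgeColoring G t) λ c → ∀ u v x → pcol p u v ≡ just x → col c u v ≡ x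

does-sym : ∀ {m} (a b : Fin m) → does (a ≟F b) ≡ does (b ≟F a)
does-sym a b with a ≟F b | b ≟F a
... | yes _ | yes _ = refl
... | no _  | no _  = refl
... | yes p | no q  = ⊥-elim (q (≡.sym p))
... | no p  | yes q = ⊥-elim (p (≡.sym q))

does-refl : ∀ {m} (a : Fin m) → does (a ≟F a) ≡ true
does-refl a with a ≟F a
... | yes _ = refl
... | no q  = ⊥-elim (q refl)

pairAdj : ∀ {n} → Graph n → Fin n × Fin 2 → Fin n × Fin 2 → Bool
pairAdj G (a , x) (b , y) =
  (does (a ≟F b) ∧ not (does (x ≟F y))) ∨ (does (x ≟F y) ∧ adj G a b)

pairAdj-sym : ∀ {n} (G : Graph n) p q → pairAdj G p q ≡ pairAdj G q p
pairAdj-sym G (a , x) (b , y)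
  rewrite does-sym a b | does-sym x y | Graph.sym G a b = refl

pairAdj-irrefl : ∀ {n} (G : Graph n) p → pairAdj G p p ≡ false
pairAdj-irrefl G (a , x) rewrite does-refl a | does-refl x | irrefl G a = refl

_□K₂ : ∀ {n} → Graph n → Graph (n * 2)
_□K₂ {n} G = record
  { adj    = λ i j → pairAdj G (remQuot 2 i) (remQuot 2 j)
  ; sym    = λ i j → pairAdj-sym G (remQuot 2 i) (remQuot 2 j)
  ; irrefl = λ i → pairAdj-irrefl G (remQuot 2 i)
  }

{-# OPTIONS --safe #-}

-- Colour every K₂-edge (rung) with one colour a and both copies of G with the other three.
-- If uv has the same colour in both copies, its two copies may be exchanged with the rungs
-- at u and v, as these four edges form a 2-coloured 4-cycle.  With a suitable a, such
-- exchanges realise the prescribed colour a on copy edges and the prescribed colours other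
-- than a on rungs.  At most k prescriptions then remain to be extended in each copy of G;
-- whatever is left of the budget k serves to prescribe auxiliary colours in G which keep
-- the exchanges away from the other prescribed edges.

module Submission where

open import Defs
open import Data.Nat using (ℕ; suc; _*_; _≤_; _<_; z≤n; s≤s)
open import Data.Nat.Properties using (≤-trans; ≤-reflexive; m≤n⇒m≤1+n)
open import Data.Bool using (true; if_then_else_)
import Data.Bool.Properties as Bool
open import Data.Fin using (Fin; zero; suc; punchIn; punchOut; combine; remQuot)
open import Data.Fin.Properties using (_≟_; any?; all?; punchIn-injective; punchInᵢ≢i;
  punchIn-punchOut; remQuot-combine; combine-remQuot; combine-injectiveˡ; combine-injectiveʳ)
open import Data.List using (List; []; _∷_; length; map; filter)
open import Data.List.Properties using (length-map; length-filter; filter-reject)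
open import Data.List.Membership.Propositional using (_∈_; lose; find)
open import Data.List.Membership.Propositional.Properties using (∈-map⁺; ∈-filter⁺)
open import Data.List.Relation.Unary.All as All using (All; []; _∷_)
open import Data.List.Relation.Unary.All.Properties using (all-filter)
open import Data.List.Relation.Unary.Any as Any using (Any; here; there)
open import Data.List.Relation.Unary.AllPairs as AllPairs using (AllPairs; []; _∷_)
import Data.List.Relation.Unary.AllPairs.Properties as AllPairs
open import Data.Maybe using (Maybe; just; nothing)
open import Data.Maybe.Properties using (just-injective)
open import Data.Product using (Σ; ∃; _×_; _,_; proj₁; proj₂)
open import Data.Sum using (_⊎_; inj₁; inj₂; [_,_])
open import Data.Empty using (⊥; ⊥-elim)
open import Function using (_∘_; id)
open import Function.Bundles using (mk⇔)
open import Relation.Nullary using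
  (¬_; Dec; does; yes; no; ¬?; _×-dec_; _⊎-dec_; _→-dec_; contradiction)
open import Relation.Nullary.Decidable using (toWitness; does-⇔; dec-true; dec-false)
open import Relation.Binary.PropositionalEquality as ≡
  using (_≡_; _≢_; refl; trans; cong; cong₂; subst; subst₂; ≢-sym)

-- The hypothesis on `G` serves `k` prescriptions per copy, so when all `k + 1` lie in one copy, one
-- of them must have the colour `a`. An exchange needs an edge with the same colour in both copies.
-- Colouring the copies alike guarantees this, but is impossible if they prescribe different colours
-- for one edge of `G`, or one colour for two edges that meet. The copies are then coloured
-- independently, with `a` different from the prescribed edge colours. Except in a triangle
-- component, a rung of colour `c` is then obtained by making `c` either missing at its vertex in
-- both copies, or present there on the same edge in both. An exchange also changes the rung at the
-- other end of its edge. For three rungs of different colours two have to be forced, and the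
-- exchanges may neither share a rung nor touch the third. Two auxiliary colours are available for
-- this; where to put them depends on the neighbours that the three vertices have outside the
-- triple.

Color : Set
Color = Fin 4

abstract
  fresh : ∀ (a b c : Color) → ∃ λ d → d ≢ a × d ≢ b × d ≢ c
  fresh = toWitness {a? = all? λ a → all? λ b → all? λ c → any? λ d →
    ¬? (d ≟ a) ×-dec ¬? (d ≟ b) ×-dec ¬? (d ≟ c)} _

  no-five-colors : ∀ (a b c d e : Color) → a ≢ b → a ≢ c → a ≢ d → b ≢ c → b ≢ d → c ≢ d →
    e ≢ a → e ≢ b → e ≢ c → e ≢ d → ⊥
  no-five-colors = toWitness {a? = all? λ a → all? λ b → all? λ c → all? λ d → all? λ e →
    ¬? (a ≟ b) →-dec ¬? (a ≟ c) →-dec ¬? (a ≟ d) →-dec ¬? (b ≟ c) →-dec ¬? (b ≟ d) →-dec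
    ¬? (c ≟ d) →-dec ¬? (e ≟ a) →-dec ¬? (e ≟ b) →-dec ¬? (e ≟ c) →-dec ¬? (e ≟ d) →-dec no id} _

  two-copies : ∀ {i j : Fin 2} → i ≢ j → ∀ k → k ≡ i ⊎ k ≡ j
  two-copies {i} {j} i≢j k = toWitness
    {a? = all? λ i → all? λ j → ¬? (i ≟ j) →-dec all? λ (k : Fin 2) → (k ≟ i) ⊎-dec (k ≟ j)}
    _ i j i≢j k

-- Prescribed colours on vertex pairs

record Entry (n t : ℕ) : Set where
  constructor _[_]_
  field
    left  : Fin n
    color : Fin t
    right : Fin n
open Entry

module _ {n t : ℕ} where

  Joins : Entry n t → Fin n → Fin n → Set
  Joins (x [ _ ] y) u v = (u ≡ x × v ≡ y) ⊎ (u ≡ y × v ≡ x)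

  abstract
    joins? : ∀ e u v → Dec (Joins e u v)
    joins? (x [ _ ] y) u v = ((u ≟ x) ×-dec (v ≟ y)) ⊎-dec ((u ≟ y) ×-dec (v ≟ x))

  joins-self : ∀ e → Joins e (left e) (right e)
  joins-self _ = inj₁ (refl , refl)

  joins-sym : ∀ e {u v} → Joins e u v → Joins e v u
  joins-sym _ (inj₁ (p , q)) = inj₂ (q , p)
  joins-sym _ (inj₂ (p , q)) = inj₁ (q , p)

  joins-unique : ∀ e {u v w} → Joins e u v → Joins e u w → v ≡ w
  joins-unique _ (inj₁ (refl , refl)) (inj₁ (_ , refl))    = refl
  joins-unique _ (inj₁ (refl , refl)) (inj₂ (refl , refl)) = refl
  joins-unique _ (inj₂ (refl , refl)) (inj₁ (refl , refl)) = refl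
  joins-unique _ (inj₂ (refl , refl)) (inj₂ (_ , refl))    = refl

  joins-end : ∀ e {u v} → Joins e u v → u ≡ left e ⊎ u ≡ right e
  joins-end _ (inj₁ (p , _)) = inj₁ p
  joins-end _ (inj₂ (p , _)) = inj₂ p

  -- Two entries can occur together in a proper colouring: where they meet, they have
  -- the same colour exactly when they are the same edge.
  Coherent : Entry n t → Entry n t → Set
  Coherent e e′ = ∀ {u v w} → Joins e u v → Joins e′ u w →
    (color e ≡ color e′ → v ≡ w) × (v ≡ w → color e ≡ color e′)

  coherent-refl : ∀ e → Coherent e e
  coherent-refl e p q = (λ _ → joins-unique e p q) , (λ _ → refl)

  coherent-sym : ∀ {e e′} → Coherent e e′ → Coherent e′ e
  coherent-sym h p q =
    (≡.sym ∘ proj₁ (h q p) ∘ ≡.sym) , (≡.sym ∘ proj₂ (h q p) ∘ ≡.sym)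

  coherent-distinct : ∀ {e e′} → color e ≢ color e′ → ¬ Joins e (left e′) (right e′) →
    Coherent e e′
  coherent-distinct {e} {e′} c≢ ¬same p q = (⊥-elim ∘ c≢) , λ { refl → ⊥-elim (¬same (same p q)) }
    where
    same : ∀ {u v} → Joins e u v → Joins e′ u v → Joins e (left e′) (right e′)
    same p (inj₁ (refl , refl)) = p
    same p (inj₂ (refl , refl)) = joins-sym e p

  coherent-disjoint : ∀ {e e′} →
    left e ≢ left e′ → left e ≢ right e′ → right e ≢ left e′ → right e ≢ right e′ → Coherent e e′
  coherent-disjoint {e} {e′} ll lr rl rr p q = ⊥-elim (disjoint (joins-end e p) (joins-end e′ q))
    where
    disjoint : ∀ {u} → u ≡ left e ⊎ u ≡ right e → u ≡ left e′ ⊎ u ≡ right e′ → ⊥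
    disjoint (inj₁ refl) (inj₁ eq) = ll eq
    disjoint (inj₁ refl) (inj₂ eq) = lr eq
    disjoint (inj₂ refl) (inj₁ eq) = rl eq
    disjoint (inj₂ refl) (inj₂ eq) = rr eq

  coherent-∈ : ∀ {es e e′} → AllPairs Coherent es → e ∈ es → e′ ∈ es → Coherent e e′
  coherent-∈ {e = e} (_ ∷ _) (here refl) (here refl) = coherent-refl e
  coherent-∈ (h ∷ _)  (here refl) (there q)   = All.lookup h q
  coherent-∈ {e = e} {e′} (h ∷ _) (there p) (here refl) = coherent-sym {e′} {e} (All.lookup h p)
  coherent-∈ (_ ∷ hs) (there p)   (there q)   = coherent-∈ hs p q

  -- The first matching entry wins; for coherent lists the order does not matter.
  paint : List (Entry n t) → Fin n → Fin n → Maybe (Fin t)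
  paint []       u v = nothing
  paint (e ∷ es) u v = if does (joins? e u v) then just (color e) else paint es u v

  paint-sym : ∀ es u v → paint es u v ≡ paint es v u
  paint-sym []       u v = refl
  paint-sym (e ∷ es) u v
    rewrite does-⇔ (mk⇔ (joins-sym e) (joins-sym e)) (joins? e u v) (joins? e v u)
          | paint-sym es u v = refl

  paint-sound : ∀ es {u v c} → paint es u v ≡ just c →
    ∃ λ e → e ∈ es × Joins e u v × color e ≡ c
  paint-sound (e ∷ es) {u} {v} eq with joins? e u v
  ... | yes j = e , here refl , j , just-injective eq
  ... | no _ with e′ , m , rest ← paint-sound es eq = e′ , there m , rest

  paint-complete : ∀ {es e u v} → e ∈ es → Joins e u v → ∃ λ c → paint es u v ≡ just c
  paint-complete {e′ ∷ es} {e} {u} {v} m j with joins? e′ u v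
  paint-complete {e′ ∷ es} m j | yes _ = color e′ , refl
  paint-complete {e′ ∷ es} (here refl) j | no ¬j = contradiction j ¬j
  paint-complete {e′ ∷ es} (there m)   j | no _  = paint-complete m j

  paint-∈ : ∀ {es e u v} → AllPairs Coherent es → e ∈ es → Joins e u v →
    paint es u v ≡ just (color e)
  paint-∈ {es} {e} hs m j
    with c , eq ← paint-complete m j
    with e′ , m′ , j′ , refl ← paint-sound es eq
    = trans eq (cong just (proj₂ (coherent-∈ hs m′ m j′ j) refl))

-- The position of c among the colours other than a (arbitrary when c ≡ a).
squeeze : Color → Color → Fin 3
squeeze a c with a ≟ c
... | yes _  = zero
... | no a≢c = punchOut a≢c

punchIn-squeeze : ∀ {a c} → c ≢ a → punchIn a (squeeze a c) ≡ c
punchIn-squeeze {a} {c} c≢a with a ≟ c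
... | yes a≡c = contradiction (≡.sym a≡c) c≢a
... | no a≢c  = punchIn-punchOut a≢c

-- Colourings of the prism and exchanges along 4-cycles

module Prism {n} (G : Graph n) where

  Adj : Fin n → Fin n → Set
  Adj u v = adj G u v ≡ true

  adj? : ∀ u v → Dec (Adj u v)
  adj? u v = adj G u v Bool.≟ true

  adj-sym : ∀ {u v} → Adj u v → Adj v u
  adj-sym {u} {v} = trans (Graph.sym G v u)

  adj-irrefl : ∀ {u} → ¬ Adj u u
  adj-irrefl {u} a with () ← trans (≡.sym a) (irrefl G u)

  paintG : ∀ {t} (es : List (Entry n t)) → AllPairs Coherent es → PartialEdgeColoring G t
  paintG {t} es hs = record
    { pcol = pc ; onEdges = on ; psymm = ps ; pproper = pp }
    where
    pc : Fin n → Fin n → Maybe (Fin t)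
    pc u v = if adj G u v then paint es u v else nothing

    on : ∀ u v c → pc u v ≡ just c → Adj u v
    on u v c eq with true ← adj G u v = refl

    sound : ∀ u v {c} → pc u v ≡ just c → ∃ λ e → e ∈ es × Joins e u v × color e ≡ c
    sound u v eq with true ← adj G u v = paint-sound es eq

    ps : ∀ u v → pc u v ≡ pc v u
    ps u v rewrite Graph.sym G u v | paint-sym es u v = refl

    pp : ∀ u v w c → v ≢ w → pc u v ≡ just c → pc u w ≡ just c → ⊥
    pp u v w c v≢w p q
      with e , m , j , refl ← sound u v p
      with e′ , m′ , j′ , eq ← sound u w q
      = v≢w (proj₁ (coherent-∈ hs m m′ j j′) (≡.sym eq))

  paintG-∈ : ∀ {t} {es : List (Entry n t)} {e u v} (hs : AllPairs Coherent es) → e ∈ es →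
    Joins e u v → Adj u v → pcol (paintG es hs) u v ≡ just (color e)
  paintG-∈ hs m j a rewrite a = paint-∈ hs m j

  paintG-size : ∀ {t} {es : List (Entry n t)} {k} (hs : AllPairs Coherent es) →
    length es ≤ k → ColorsAtMost (paintG es hs) k
  paintG-size {es = es} hs le =
    map ends es , ≤-trans (≤-reflexive (length-map ends es)) le , covered
    where
    ends : Entry n _ → Fin n × Fin n
    ends e = left e , right e
    covered : ∀ u v c → pcol (paintG es hs) u v ≡ just c →
      (u , v) ∈ map ends es ⊎ (v , u) ∈ map ends es
    covered u v c eq with true ← adj G u v with paint-sound es eq
    ... | e , m , inj₁ (refl , refl) , _ = inj₁ (∈-map⁺ ends m)
    ... | e , m , inj₂ (refl , refl) , _ = inj₂ (∈-map⁺ ends m)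

  -- The guard `Adj u v` makes an entry on a non-edge vacuous, so an auxiliary colour can be
  -- prescribed for a pair without deciding whether it is adjacent.
  Agrees : (Fin n → Fin n → Color) → Entry n 4 → Set
  Agrees g e = ∀ {u v} → Joins e u v → Adj u v → g u v ≡ color e

  record AvoidingColoring (a : Color) : Set where
    field
      hue     : Fin n → Fin n → Color
      hue-sym : ∀ {u v} → Adj u v → hue u v ≡ hue v u
      hue-inj : ∀ {u v w} → Adj u v → Adj u w → hue u v ≡ hue u w → v ≡ w
      hue≢    : ∀ {u v} → Adj u v → hue u v ≢ a
  open AvoidingColoring public

  -- A proper 4-edge-colouring of G □ K₂: its restriction to each copy of G, and the
  -- colours of the K₂-edges.
  record PrismColoring : Set where
    field
      copy      : Fin 2 → Fin n → Fin n → Color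
      rung      : Fin n → Color
      copy-sym  : ∀ i {u v} → Adj u v → copy i u v ≡ copy i v u
      copy-inj  : ∀ i {u v w} → Adj u v → Adj u w → copy i u v ≡ copy i u w → v ≡ w
      copy≢rung : ∀ i {u v} → Adj u v → copy i u v ≢ rung u
  open PrismColoring public

  prism : ∀ {a} → (Fin 2 → AvoidingColoring a) → PrismColoring
  prism {a} F = record
    { copy = hue ∘ F ; rung = λ _ → a
    ; copy-sym = hue-sym ∘ F ; copy-inj = hue-inj ∘ F ; copy≢rung = hue≢ ∘ F }

  -- Give colour a to the edges of the matching S in both copies, and colour m u to the rung at u.
  record Recoloring (φ : PrismColoring) (a : Color) : Set₁ where
    field
      S       : Fin n → Fin n → Set
      S?      : ∀ u v → Dec (S u v)
      S-sym   : ∀ {u v} → S u v → S v u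
      S-match : ∀ {u v w} → S u v → S u w → v ≡ w
      S-rung  : ∀ {u v} → S u v → rung φ u ≡ a
      m       : Fin n → Color
      m≢a     : ∀ {u v} → S u v → m u ≢ a
      m≢copy  : ∀ i {u v} → Adj u v → ¬ S u v → copy φ i u v ≢ m u

    newCopy : Fin 2 → Fin n → Fin n → Color
    newCopy i u v = if does (S? u v) then a else copy φ i u v

    recolored : ∀ i {u v} → S u v → newCopy i u v ≡ a
    recolored i {u} {v} s rewrite dec-true (S? u v) s = refl

    kept : ∀ i {u v} → ¬ S u v → newCopy i u v ≡ copy φ i u v
    kept i {u} {v} ¬s rewrite dec-false (S? u v) ¬s = refl

    new : ∀ i {u v} → newCopy i u v ≢ a → newCopy i u v ≡ copy φ i u v
    new i {u} {v} ≢a with S? u v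
    ... | yes _ = contradiction refl ≢a
    ... | no _  = refl

    recolor : PrismColoring
    recolor = record { copy = newCopy ; rung = m
      ; copy-sym = csym ; copy-inj = cinj ; copy≢rung = crung }
      where
      csym : ∀ i {u v} → Adj u v → newCopy i u v ≡ newCopy i v u
      csym i {u} {v} uv
        rewrite does-⇔ (mk⇔ S-sym S-sym) (S? u v) (S? v u) | copy-sym φ i uv = refl

      cinj : ∀ i {u v w} → Adj u v → Adj u w → newCopy i u v ≡ newCopy i u w → v ≡ w
      cinj i {u} {v} {w} uv uw eq with S? u v | S? u w
      ... | yes s | yes s′ = S-match s s′
      -- At an end of an exchanged edge the old rung had colour `a`, so no kept edge there has it.
      ... | yes s | no _   = ⊥-elim (copy≢rung φ i uw (trans (≡.sym eq) (≡.sym (S-rung s))))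
      ... | no _  | yes s  = ⊥-elim (copy≢rung φ i uv (trans eq (≡.sym (S-rung s))))
      ... | no _  | no _   = copy-inj φ i uv uw eq

      crung : ∀ i {u v} → Adj u v → newCopy i u v ≢ m u
      crung i {u} {v} uv with S? u v
      ... | yes s = ≢-sym (m≢a s)
      ... | no ¬s = m≢copy i uv ¬s

  -- An exchanged edge had colour `c` in both copies, so the side conditions can test copy `zero`
  -- alone. Besides `u`, only the far end of that edge gets a new rung colour.
  record Forced (φ : PrismColoring) (a : Color) (u : Fin n) (c : Color) : Set where
    field
      result         : PrismColoring
      rung-at        : rung result u ≡ c
      rung-elsewhere : ∀ {z} → z ≢ u → (Adj u z → copy φ zero u z ≢ c) →
                       rung result z ≡ rung φ z
      copy-kept      : ∀ i {x y} → ¬ (x ≡ u ⊎ y ≡ u) ⊎ copy φ zero x y ≢ c →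
                       copy result i x y ≡ copy φ i x y
      copy-new       : ∀ i {x y} → copy result i x y ≢ a → copy result i x y ≡ copy φ i x y
  open Forced public

  -- The c-coloured edge uv, if there is one, is exchanged with the rungs of the 4-cycle
  -- it spans with its parallel edge.
  force : ∀ (φ : PrismColoring) {a u c} → c ≢ a → rung φ u ≡ a →
    (∀ i j {v} → Adj u v → copy φ i u v ≡ c → copy φ j u v ≡ c) →
    (∀ {v} → Adj u v → copy φ zero u v ≡ c → rung φ v ≡ a) →
    Forced φ a u c
  force φ {a} {u} {c} c≢a ru same rv = record
    { result = recolor
    ; rung-at = m-at (inj₁ refl)
    ; rung-elsewhere = λ { z≢u free → m-off [ z≢u , (λ { (uz , _ , cz) → free uz cz }) ] }
    ; copy-kept = λ { i (inj₁ off) → kept i (off ∘ proj₁ ∘ proj₂)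
                    ; i (inj₂ ≢c)  → kept i (≢c ∘ proj₂ ∘ proj₂) }
    ; copy-new = new }
    where
    T : Fin n → Fin n → Set
    T x y = Adj x y × (x ≡ u ⊎ y ≡ u) × copy φ zero x y ≡ c

    T? : ∀ x y → Dec (T x y)
    T? x y = adj? x y ×-dec ((x ≟ u) ⊎-dec (y ≟ u)) ×-dec (copy φ zero x y ≟ c)

    T-sym : ∀ {x y} → T x y → T y x
    T-sym (xy , e , eq) = adj-sym xy , [ inj₂ , inj₁ ] e , trans (copy-sym φ zero (adj-sym xy)) eq

    abstract
      at? : ∀ z → Dec (z ≡ u ⊎ T u z)
      at? z = (z ≟ u) ⊎-dec T? u z

    m₀ : Fin n → Color
    m₀ z = if does (at? z) then c else rung φ z

    m-at : ∀ {z} → z ≡ u ⊎ T u z → m₀ z ≡ c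
    m-at {z} h rewrite dec-true (at? z) h = refl

    m-off : ∀ {z} → ¬ (z ≡ u ⊎ T u z) → m₀ z ≡ rung φ z
    m-off {z} h rewrite dec-false (at? z) h = refl

    T-at : ∀ {x y} → T x y → x ≡ u ⊎ T u x
    T-at (_ , inj₁ refl , _) = inj₁ refl
    T-at t@(_ , inj₂ refl , _) = inj₂ (T-sym t)

    -- The rung turns to `c` only at `u` and at the far end of the exchanged edge, and by properness
    -- that edge was the only one coloured `c` there.
    m≢copy₀ : ∀ i {x y} → Adj x y → ¬ T x y → copy φ i x y ≢ m₀ x
    m≢copy₀ i {x} {y} xy ¬t with at? x
    ... | yes (inj₁ refl) = λ eq → ¬t (xy , inj₁ refl , same i zero xy eq)
    ... | yes (inj₂ t@(ux , _ , eq₀)) = λ eq → ¬t (subst (T x)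
      (copy-inj φ i (adj-sym ux) xy (trans (copy-sym φ i (adj-sym ux))
        (trans (same zero i ux eq₀) (≡.sym eq)))) (T-sym t))
    ... | no _ = copy≢rung φ i xy

    recoloring : Recoloring φ a
    recoloring = record
      { S = T ; S? = T? ; S-sym = T-sym
      ; S-match = λ { (xy , _ , p) (xz , _ , q) → copy-inj φ zero xy xz (trans p (≡.sym q)) }
      ; S-rung = λ { (_ , inj₁ refl , _) → ru
                   ; (xy , inj₂ refl , eq) →
                       rv (adj-sym xy) (trans (copy-sym φ zero (adj-sym xy)) eq) }
      ; m = m₀
      ; m≢a = λ t eq → c≢a (trans (≡.sym (m-at (T-at t))) eq)
      ; m≢copy = m≢copy₀ }

    open Recoloring recoloring

  -- Both conditions of `force` hold vacuously: no edge is exchanged and only the rung at `u`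
  -- changes.
  force-missing : ∀ (φ : PrismColoring) {a u c} → c ≢ a → rung φ u ≡ a →
    (∀ i {v} → Adj u v → copy φ i u v ≢ c) → Forced φ a u c
  force-missing φ c≢a ru miss = force φ c≢a ru
    (λ i j uv eq → ⊥-elim (miss i uv eq)) (λ uv eq → ⊥-elim (miss zero uv eq))

  -- At `v` the colour of `e` is already taken by the edge to `x`.
  blocked : ∀ φ i {e v x u} → Agrees (copy φ i) e → Adj v x → Joins e v x → u ≢ x → Adj u v →
    copy φ i u v ≢ color e
  blocked φ i ag vx j u≢x uv eq = u≢x (copy-inj φ i (adj-sym uv) vx
    (trans (copy-sym φ i (adj-sym uv)) (trans eq (≡.sym (ag j vx)))))

-- Extending prescriptions in G and forcing rungs

module Extension {n} (G : Graph n) (k : ℕ)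
  (ext : ∀ (p : PartialEdgeColoring G 3) → ColorsAtMost p k → Extendable p) where
  open Prism G

  record Admissible (a : Color) (es : List (Entry n 4)) : Set where
    constructor admissible
    field
      size     : length es ≤ k
      avoids   : All (λ e → color e ≢ a) es
      coherent : AllPairs Coherent es

  abstract
    -- Without `a` three colours remain; `squeeze a` renames them for the hypothesis on `G`, and
    -- `punchIn a` renames back without ever producing `a`.
    extend : ∀ {a es} → Admissible a es → Σ (AvoidingColoring a) λ F → All (Agrees (hue F)) es
    extend {a} {es} (admissible size avoids coherent) = F , All.tabulate agrees
      where
      squeezeE : Entry n 4 → Entry n 3
      squeezeE (x [ c ] y) = x [ squeeze a c ] y

      squeeze-coherent : ∀ {e e′} → color e ≢ a → color e′ ≢ a → Coherent e e′ →
        Coherent (squeezeE e) (squeezeE e′)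
      squeeze-coherent ≢a ≢a′ h p q =
        (λ eq → proj₁ (h p q) (trans (≡.sym (punchIn-squeeze ≢a))
                  (trans (cong (punchIn a) eq) (punchIn-squeeze ≢a′)))) ,
        cong (squeeze a) ∘ proj₂ (h p q)

      squeeze-all : ∀ {es} → All (λ e → color e ≢ a) es → AllPairs Coherent es →
        AllPairs Coherent (map squeezeE es)
      squeeze-all [] [] = []
      squeeze-all {e ∷ es} (≢a ∷ ≢as) (h ∷ hs) = heads ≢as h ∷ squeeze-all ≢as hs
        where
        heads : ∀ {es} → All (λ e → color e ≢ a) es → All (Coherent e) es →
          All (Coherent (squeezeE e)) (map squeezeE es)
        heads [] [] = []
        heads {e′ ∷ _} (≢a′ ∷ ≢as) (h ∷ hs) = squeeze-coherent {e} {e′} ≢a ≢a′ h ∷ heads ≢as hs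

      small : AllPairs Coherent (map squeezeE es)
      small = squeeze-all avoids coherent

      extended : Extendable (paintG (map squeezeE es) small)
      extended = ext (paintG (map squeezeE es) small)
        (paintG-size small (≤-trans (≤-reflexive (length-map squeezeE es)) size))

      χ : ProperEdgeColoring G 3
      χ = proj₁ extended

      F : AvoidingColoring a
      F = record
        { hue = λ u v → punchIn a (col χ u v)
        ; hue-sym = λ uv → cong (punchIn a) (symm χ _ _ uv)
        ; hue-inj = inj
        ; hue≢ = λ _ → punchInᵢ≢i a _ }
        where
        inj : ∀ {u v w} → Adj u v → Adj u w →
          punchIn a (col χ u v) ≡ punchIn a (col χ u w) → v ≡ w
        inj {u} {v} {w} uv uw eq with v ≟ w
        ... | yes v≡w = v≡w
        ... | no v≢w  = contradiction (punchIn-injective a _ _ eq) (proper χ u v w uv uw v≢w)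

      agrees : ∀ {e} → e ∈ es → Agrees (hue F) e
      agrees m j uv = trans
        (cong (punchIn a) (proj₂ extended _ _ _ (paintG-∈ small (∈-map⁺ squeezeE m) j uv)))
        (punchIn-squeeze (All.lookup avoids m))

  -- A constant rung colour makes the copies independent, so each has the full budget `k`.
  plain₂ : ∀ {i j a es es′} → i ≢ j → Admissible a es → Admissible a es′ →
    Σ PrismColoring λ φ → All (Agrees (copy φ i)) es × All (Agrees (copy φ j)) es′ ×
      (∀ u → rung φ u ≡ a)
  plain₂ {i} {j} {a} {es} {es′} i≢j adm adm′ =
    φ , at-i , at-j , λ _ → refl
    where
    pick : Fin 2 → AvoidingColoring a
    pick l = if does (l ≟ i) then proj₁ (extend adm) else proj₁ (extend adm′)
    φ = prism pick
    at-i : All (Agrees (copy φ i)) es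
    at-i rewrite dec-true (i ≟ i) refl = proj₂ (extend adm)
    at-j : All (Agrees (copy φ j)) es′
    at-j rewrite dec-false (j ≟ i) (≢-sym i≢j) = proj₂ (extend adm′)

  -- Rungs get the colour of the first entry; edges that should have it too are then
  -- exchanged with the rungs of their 4-cycles, so only the other entries use up the
  -- budget k.
  flat : ∀ {e es} → length es ≤ k → AllPairs Coherent (e ∷ es) →
    All (λ e′ → Adj (left e′) (right e′)) (e ∷ es) →
    Σ PrismColoring λ φ → (∀ i → All (Agrees (copy φ i)) (e ∷ es)) ×
      (∀ u → All (λ e′ → color e′ ≡ color e → u ≢ left e′ × u ≢ right e′) (e ∷ es) →
        rung φ u ≡ color e)
  flat {e} {es} size coherent adjacent = recolor , (λ i → All.tabulate (agrees i)) , rung-kept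
    where
    a : Color
    a = color e

    others : List (Entry n 4)
    others = filter (λ e′ → ¬? (color e′ ≟ a)) (e ∷ es)

    extended : Σ (AvoidingColoring a) λ F → All (Agrees (hue F)) others
    extended = extend (admissible
      -- The filter drops `e` itself, which is where one prescription is saved.
      (≤-trans (≤-reflexive (cong length
                 (filter-reject (λ e′ → ¬? (color e′ ≟ a)) {x = e} {xs = es} λ ≢a → ≢a refl)))
               (≤-trans (length-filter (λ e′ → ¬? (color e′ ≟ a)) es) size))
      (all-filter (λ e′ → ¬? (color e′ ≟ a)) (e ∷ es))
      (AllPairs.filter⁺ (λ e′ → ¬? (color e′ ≟ a)) coherent))

    F : AvoidingColoring a
    F = proj₁ extended

    T : Fin n → Fin n → Set
    T u v = Any (λ e′ → Joins e′ u v × color e′ ≡ a) (e ∷ es)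

    T? : ∀ u v → Dec (T u v)
    T? u v = Any.any? (λ e′ → joins? e′ u v ×-dec (color e′ ≟ a)) (e ∷ es)

    T-match : ∀ {u v w} → T u v → T u w → v ≡ w
    T-match s t with _ , m , j , eq ← find s | _ , m′ , j′ , eq′ ← find t =
      proj₁ (coherent-∈ coherent m m′ j j′) (trans eq (≡.sym eq′))

    T-adj : ∀ {u v} → T u v → Adj u v
    T-adj t with find t
    ... | _ , m , inj₁ (refl , refl) , _ = All.lookup adjacent m
    ... | _ , m , inj₂ (refl , refl) , _ = adj-sym (All.lookup adjacent m)

    m₀ : Fin n → Color
    m₀ u with any? (T? u)
    ... | yes (v , _) = hue F u v
    ... | no _        = a

    m₀≢a : ∀ {u v} → T u v → m₀ u ≢ a
    m₀≢a {u} t with any? (T? u)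
    ... | yes (_ , t′) = hue≢ F (T-adj t′)
    ... | no ¬t        = contradiction (_ , t) ¬t

    m₀≢copy : ∀ {u v} → Adj u v → ¬ T u v → hue F u v ≢ m₀ u
    m₀≢copy {u} uv ¬t with any? (T? u)
    ... | yes (w , t) = λ eq → ¬t (subst (T u) (≡.sym (hue-inj F uv (T-adj t) eq)) t)
    ... | no _        = hue≢ F uv

    recoloring : Recoloring (prism (λ _ → F)) a
    recoloring = record
      { S = T ; S? = T?
      ; S-sym = Any.map λ { {e′} (j , eq) → joins-sym e′ j , eq }
      ; S-match = T-match ; S-rung = λ _ → refl
      ; m = m₀ ; m≢a = m₀≢a ; m≢copy = λ _ → m₀≢copy }

    open Recoloring recoloring

    agrees : ∀ i {e′} → e′ ∈ e ∷ es → Agrees (copy recolor i) e′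
    agrees i {e′} m j uv with color e′ ≟ a
    ... | yes eq = trans (recolored i (lose m (j , eq))) (≡.sym eq)
    ... | no ≢a  = trans (kept i untouched)
      (All.lookup (proj₂ extended) (∈-filter⁺ (λ e′ → ¬? (color e′ ≟ a)) m ≢a) j uv)
      where
      untouched : ¬ T _ _
      untouched t with _ , m′ , j′ , eq ← find t =
        ≢a (trans (proj₂ (coherent-∈ coherent m m′ j j′) refl) eq)

    rung-kept : ∀ u → All (λ e′ → color e′ ≡ a → u ≢ left e′ × u ≢ right e′) (e ∷ es) →
      m₀ u ≡ a
    rung-kept u off with any? (T? u)
    ... | no _ = refl
    ... | yes (v , t) with e′ , m , j , eq ← find t
                      with u≢l , u≢r ← All.lookup off m eq
                      = ⊥-elim ([ u≢l , u≢r ] (joins-end e′ j))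

  agrees-join : ∀ {g e s x} → Joins e s x → Agrees g (s [ color e ] x) → Agrees g e
  agrees-join (inj₁ (refl , refl)) ag = ag
  agrees-join (inj₂ (refl , refl)) ag = ag ∘ [ inj₂ , inj₁ ]

  agrees-forced-off : ∀ {φ a u c e} (fd : Forced φ a u c) i →
    Agrees (copy φ i) e → u ≢ left e × u ≢ right e → Agrees (copy (result fd) i) e
  agrees-forced-off {e = e} fd i ag (u≢l , u≢r) j xy = trans (copy-kept fd i (inj₁
    [ (λ { refl → [ u≢l , u≢r ] (joins-end e j) })
    , (λ { refl → [ u≢l , u≢r ] (joins-end e (joins-sym e j)) }) ])) (ag j xy)

  -- An exchanged edge has colour `c` and ends at `u`; an entry lacking either property survives.
  -- Agreement in copy `zero` enters because `copy-kept` tests the colour there.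
  agrees-forced : ∀ {φ a u c e} (fd : Forced φ a u c) i →
    Agrees (copy φ zero) e → Agrees (copy φ i) e → (color e ≡ c → u ≢ left e × u ≢ right e) →
    Agrees (copy (result fd) i) e
  agrees-forced {c = c} {e} fd i ag₀ ag off j xy with color e ≟ c
  ... | no ≢c = trans (copy-kept fd i (inj₂ (≢c ∘ trans (≡.sym (ag₀ j xy))))) (ag j xy)
  ... | yes eq = agrees-forced-off {e = e} fd i ag (off eq) j xy

  force-flat : ∀ {a u c} (F : AvoidingColoring a) → c ≢ a → Forced (prism (λ _ → F)) a u c
  force-flat F c≢a = force (prism (λ _ → F)) c≢a refl (λ _ _ _ → id) (λ _ _ → refl)

  -- By properness `uw` is the only edge at `u` coloured `c`, in either copy.
  force-edge : ∀ φ {a u w c} → c ≢ a → (∀ z → rung φ z ≡ a) → Adj u w →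
    (∀ l → copy φ l u w ≡ c) → Forced φ a u c
  force-edge φ c≢a ra uw at = force φ c≢a (ra _) same (λ _ _ → ra _)
    where
    same : ∀ i j {v} → Adj _ v → copy φ i _ v ≡ _ → copy φ j _ v ≡ _
    same i j uv eq with refl ← copy-inj φ i uv uw (trans eq (≡.sym (at i))) = at j

  -- The exchange at `u` is followed by one at `v`. The conditions on `uv` and on common neighbours
  -- keep the two 4-cycles from sharing a rung; those on `uz` and `vz` protect the rung at `z`.
  force-two : ∀ {a u v z c d} (F : AvoidingColoring a) → c ≢ a → d ≢ a → c ≢ d → u ≢ v →
    z ≢ u → z ≢ v →
    (Adj u v → hue F u v ≢ c × hue F u v ≢ d) →
    (∀ {w} → Adj u w → Adj v w → hue F u w ≡ c → hue F v w ≢ d) →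
    (Adj u z → hue F u z ≢ c) → (Adj v z → hue F v z ≢ d) →
    Σ PrismColoring λ φ → rung φ u ≡ c × rung φ v ≡ d × rung φ z ≡ a
  force-two {a} {u} {v} {z} {c} {d} F c≢a d≢a c≢d u≢v z≢u z≢v uv≢ common uz≢ vz≢ =
    result second ,
    trans (rung-elsewhere second u≢v vu≢d) (rung-at first) ,
    rung-at second ,
    trans (rung-elsewhere second z≢v (λ vz → vz≢ vz ∘ old zero))
          (rung-elsewhere first z≢u uz≢)
    where
    first : Forced (prism (λ _ → F)) a u c
    first = force-flat F c≢a

    φ₁ : PrismColoring
    φ₁ = result first

    -- The first exchange only turns edges of colour `c` into `a`, so the colour class `d` is still
    -- that of `F` in both copies.
    old : ∀ i {x y} → copy φ₁ i x y ≡ d → hue F x y ≡ d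
    old i eq = trans (≡.sym (copy-new first i (d≢a ∘ trans (≡.sym eq)))) eq

    new : ∀ i {x y} → hue F x y ≡ d → copy φ₁ i x y ≡ d
    new i eq = trans (copy-kept first i (inj₂ (c≢d ∘ ≡.sym ∘ trans (≡.sym eq)))) eq

    vu≢d : Adj v u → copy φ₁ zero v u ≢ d
    vu≢d vu eq = proj₂ (uv≢ (adj-sym vu)) (trans (hue-sym F (adj-sym vu)) (old zero eq))

    rung-v : ∀ {w} → Adj v w → copy φ₁ zero v w ≡ d → rung φ₁ w ≡ a
    rung-v vw eq = rung-elsewhere first (λ { refl → vu≢d vw eq })
      (λ uw cw → common uw vw cw (old zero eq))

    second : Forced φ₁ a v d
    second = force φ₁ d≢a (rung-elsewhere first (≢-sym u≢v) (proj₁ ∘ uv≢))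
      (λ i j _ → new j ∘ old i) rung-v

  -- Equally coloured entries are compatible when they are the same pair or disjoint. The other
  -- alternative is the one that `flat` cannot treat.
  coherent-or-meet : ∀ (e e′ : Entry n 4) → color e ≡ color e′ →
    Coherent e e′ ⊎ ∃ λ s → ∃ λ x → ∃ λ z → Joins e s x × Joins e′ s z × x ≢ z
  coherent-or-meet e@(x [ c ] y) e′@(z [ _ ] w) refl with x ≟ z | y ≟ w | x ≟ w | y ≟ z
  ... | yes refl | yes refl | _ | _ = inj₁ (coherent-refl e)
  ... | yes refl | no y≢w   | _ | _ =
    inj₂ (x , y , w , inj₁ (refl , refl) , inj₁ (refl , refl) , y≢w)
  ... | no x≢z | yes refl | _ | _ =
    inj₂ (y , x , z , inj₂ (refl , refl) , inj₂ (refl , refl) , x≢z)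
  ... | no _ | no _ | yes refl | yes refl =
    inj₁ λ p q → (λ _ → joins-unique e p ([ inj₂ , inj₁ ] q)) , λ _ → refl
  ... | no _ | no _ | yes refl | no y≢z =
    inj₂ (x , y , z , inj₁ (refl , refl) , inj₂ (refl , refl) , y≢z)
  ... | no _ | no _ | no x≢w | yes refl =
    inj₂ (y , x , w , inj₂ (refl , refl) , inj₁ (refl , refl) , x≢w)
  ... | no x≢z | no y≢w | no x≢w | no y≢z = inj₁ (coherent-disjoint {e = e} {e′} x≢z x≢w y≢z y≢w)

  abstract
    other-neighbor? : ∀ u v z → Dec (∃ λ w → Adj u w × w ≢ v × w ≢ z)
    other-neighbor? u v z = any? λ w → adj? u w ×-dec ¬? (w ≟ v) ×-dec ¬? (w ≟ z)

  neighbor-in : ∀ {u v z} → ¬ (∃ λ w → Adj u w × w ≢ v × w ≢ z) →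
    ∀ {w} → Adj u w → w ≡ v ⊎ w ≡ z
  neighbor-in {u} {v} {z} none {w} uw with w ≟ v | w ≟ z
  ... | yes eq | _      = inj₁ eq
  ... | no _   | yes eq = inj₂ eq
  ... | no ≢v  | no ≢z  = contradiction (w , uw , ≢v , ≢z) none

  admissible₁ : ∀ {a} e → 1 ≤ k → color e ≢ a → Admissible a (e ∷ [])
  admissible₁ _ 1≤k ≢a = admissible 1≤k (≢a ∷ []) ([] ∷ [])

  admissible₂ : ∀ {a} e e′ → 2 ≤ k → color e ≢ a → color e′ ≢ a → Coherent e e′ →
    Admissible a (e ∷ e′ ∷ [])
  admissible₂ _ _ 2≤k ≢a ≢a′ h = admissible 2≤k (≢a ∷ ≢a′ ∷ []) ((h ∷ []) ∷ [] ∷ [])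

  -- A further neighbour w of x would allow the disjoint edges xw and yu to be coloured
  -- differently, leaving only one colour for both xu and xy.
  triangle-closed : 2 ≤ k → ∀ {x y u w} → Adj x y → Adj y u → Adj u x → Adj x w →
    w ≡ u ⊎ w ≡ y
  triangle-closed 2≤k {x} {y} {u} {w} xy yu ux xw with w ≟ u | w ≟ y
  ... | yes eq | _      = inj₁ eq
  ... | no _   | yes eq = inj₂ eq
  ... | no w≢u | no w≢y
    with F , xw₁ ∷ yu₂ ∷ [] ← extend (admissible₂ {zero} (x [ suc zero ] w)
           (y [ suc (suc zero) ] u) 2≤k (λ ()) (λ ()) (coherent-distinct (λ ())
             [ (λ { (_ , u≡w) → w≢u (≡.sym u≡w) }) , (λ { (y≡w , _) → w≢y (≡.sym y≡w) }) ]))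
    = ⊥-elim (no-five-colors zero (suc zero) (suc (suc zero)) (hue F x u) (hue F x y)
        (λ ()) (λ ()) (≢-sym (hue≢ F xu)) (λ ())
        (λ eq → w≢u (hue-inj F xw xu (trans (xw₁ (inj₁ (refl , refl)) xw) eq)))
        (λ eq → adj-irrefl (subst (Adj x) (hue-inj F (adj-sym yu) ux
                  (trans (yu₂ (inj₂ (refl , refl)) (adj-sym yu)) (trans eq (hue-sym F xu)))) xy))
        (hue≢ F xy)
        (λ eq → w≢y (≡.sym (hue-inj F xy xw (trans eq (≡.sym (xw₁ (inj₁ (refl , refl)) xw))))))
        (λ eq → adj-irrefl (subst (Adj x) (≡.sym (hue-inj F (adj-sym xy) yu
                  (trans (hue-sym F (adj-sym xy)) (trans eq
                    (≡.sym (yu₂ (inj₁ (refl , refl)) yu)))))) xu))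
        (λ eq → adj-irrefl (subst (Adj y) (≡.sym (hue-inj F xy xu eq)) yu)))
    where
    xu : Adj x u
    xu = adj-sym ux

  -- Prescriptions on the prism; at most two of them

  module Prescribed (p : PartialEdgeColoring (G □K₂) 4) where

    OnRung : Fin n → Color → Set
    OnRung u c = pcol p (combine u zero) (combine u (suc zero)) ≡ just c

    OnCopy : Fin 2 → Entry n 4 → Set
    OnCopy i e = pcol p (combine (left e) i) (combine (right e) i) ≡ just (color e)

    pairAdj-cases : ∀ {x y i j} → pairAdj G (x , i) (y , j) ≡ true →
      (x ≡ y × i ≢ j) ⊎ (i ≡ j × Adj x y)
    pairAdj-cases {x} {y} {i} {j} eq with x ≟ y | i ≟ j
    ... | yes x≡y | no i≢j  = inj₁ (x≡y , i≢j)
    ... | yes _   | yes i≡j = inj₂ (i≡j , eq)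
    ... | no _    | yes i≡j = inj₂ (i≡j , eq)

    colored-cases : ∀ {x i y j c} → pcol p (combine x i) (combine y j) ≡ just c →
      (x ≡ y × i ≢ j) ⊎ (i ≡ j × Adj x y)
    colored-cases {x} {i} {y} {j} eq = pairAdj-cases (subst (_≡ true)
      (cong₂ (pairAdj G) (remQuot-combine x i) (remQuot-combine y j)) (onEdges p _ _ _ eq))

    onCopy-adj : ∀ {i e} → OnCopy i e → Adj (left e) (right e)
    onCopy-adj h with colored-cases h
    ... | inj₁ (_ , i≢i) = contradiction refl i≢i
    ... | inj₂ (_ , xy)  = xy

    onCopy-join : ∀ {i e u v} → OnCopy i e → Joins e u v → OnCopy i (u [ color e ] v)
    onCopy-join h (inj₁ (refl , refl)) = h
    onCopy-join h (inj₂ (refl , refl)) = trans (psymm p _ _) h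

    onCopy-coherent : ∀ {i e e′} → OnCopy i e → OnCopy i e′ → Coherent e e′
    onCopy-coherent {i} {e} {e′} h h′ {u} {v} {w} j j′ = same-end , same-color
      where
      hv : OnCopy i (u [ color e ] v)
      hv = onCopy-join {i} {e} h j
      hw : OnCopy i (u [ color e′ ] w)
      hw = onCopy-join {i} {e′} h′ j′
      same-end : color e ≡ color e′ → v ≡ w
      same-end refl with v ≟ w
      ... | yes v≡w = v≡w
      ... | no v≢w  = ⊥-elim (pproper p _ _ _ _ (v≢w ∘ combine-injectiveˡ v i w i) hv hw)
      same-color : v ≡ w → color e ≡ color e′
      same-color refl = just-injective (trans (≡.sym hv) hw)

    rung-unique : ∀ {u v c d} → OnRung u c → OnRung v d → c ≢ d → u ≢ v
    rung-unique h h′ c≢d refl = c≢d (just-injective (trans (≡.sym h) h′))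

    rung-off-left : ∀ {u c i e} → OnRung u c → OnCopy i e → color e ≡ c → u ≢ left e
    rung-off-left {u} {i = i} {e} h h′ refl refl = at i h′
      where
      at : ∀ i → ¬ OnCopy i e
      at zero g = pproper p _ _ _ _
        ((λ ()) ∘ combine-injectiveʳ u (suc zero) (right e) zero) h g
      at (suc zero) g = pproper p _ _ _ _
        ((λ ()) ∘ combine-injectiveʳ u zero (right e) (suc zero)) (trans (psymm p _ _) h) g

    -- This is properness of `p`. It allows `e` to be exchanged while the rung at `u` keeps its
    -- colour, and conversely.
    rung-off : ∀ {u c i e} → OnRung u c → OnCopy i e → color e ≡ c → u ≢ left e × u ≢ right e
    rung-off {e = e} h h′ eq =
      rung-off-left {e = e} h h′ eq ,
      rung-off-left {e = right e [ color e ] left e} h (trans (psymm p _ _) h′) eq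

    -- In the names solve-…, R stands for a prescribed rung and C for a prescribed copy edge.
    solve-C : ∀ {i e} → OnCopy i e → Σ PrismColoring λ φ → Agrees (copy φ i) e
    solve-C {i} {e} h with φ , ag , _ ← flat {e} {[]} z≤n ([] ∷ []) (onCopy-adj {e = e} h ∷ [])
      with at ∷ [] ← ag i = φ , at

    plain-R : ∀ c → Σ PrismColoring λ φ → ∀ u → rung φ u ≡ c
    plain-R c with F , _ ← extend {c} {[]} (admissible z≤n [] []) = prism (λ _ → F) , λ _ → refl

    solve-RR : 1 ≤ k → ∀ {u c v d} → OnRung u c → OnRung v d →
      Σ PrismColoring λ φ → rung φ u ≡ c × rung φ v ≡ d
    solve-RR 1≤k {u} {c} {v} {d} hu hv with c ≟ d | fresh c d d
    ... | yes refl | _ with φ , r ← plain-R c = φ , r u , r v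
    solve-RR 1≤k {u} {c} {v} {d} hu hv | no c≢d | b , b≢c , b≢d , _
      -- With `b` on `uv`, the edge exchanged at `v` does not end at `u`.
      with F , vu ∷ [] ← extend (admissible₁ (v [ b ] u) 1≤k b≢c)
      = result forced , rung-elsewhere forced (rung-unique hu hv c≢d)
          (λ a eq → b≢d (trans (≡.sym (vu (inj₁ (refl , refl)) a)) eq)) , rung-at forced
      where
      forced : Forced (prism (λ _ → F)) c v d
      forced = force-flat F (≢-sym c≢d)

    solve-RC : 1 ≤ k → ∀ {u c i e} → OnRung u c → OnCopy i e →
      Σ PrismColoring λ φ → rung φ u ≡ c × Agrees (copy φ i) e
    solve-RC 1≤k {u} {c} {i} {e} hu he with color e ≟ c
    ... | yes refl
      with φ , ag , r ← flat {e} {[]} z≤n ([] ∷ []) (onCopy-adj {e = e} he ∷ [])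
      with at ∷ [] ← ag i = φ , r u (rung-off {e = e} hu he ∷ []) , at
    solve-RC 1≤k {u} {c} {i} {e} hu he | no ≢c
      with F , at ∷ [] ← extend (admissible₁ e 1≤k ≢c) = prism (λ _ → F) , refl , at

    solve-CC : 1 ≤ k → ∀ {i e j e′} → OnCopy i e → OnCopy j e′ →
      Σ PrismColoring λ φ → Agrees (copy φ i) e × Agrees (copy φ j) e′
    solve-CC 1≤k {i} {e} {j} {e′} h h′ with i ≟ j | fresh (color e) (color e′) (color e′)
    ... | yes refl | _
      with φ , ag , _ ← flat {e} {e′ ∷ []} 1≤k
             ((onCopy-coherent {e = e} {e′} h h′ ∷ []) ∷ [] ∷ [])
             (onCopy-adj {e = e} h ∷ onCopy-adj {e = e′} h′ ∷ [])
      with at ∷ at′ ∷ [] ← ag i = φ , at , at′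
    solve-CC 1≤k {i} {e} {j} {e′} h h′ | no i≢j | a , a≢ , a≢′ , _
      with φ , at ∷ [] , at′ ∷ [] , _ ← plain₂ i≢j (admissible₁ e 1≤k (≢-sym a≢))
             (admissible₁ e′ 1≤k (≢-sym a≢′)) = φ , at , at′

    -- Three prescriptions: the simpler cases

    solve-RRR-equal : 2 ≤ k → ∀ {u v w c d} → c ≢ d → OnRung u c → OnRung v c → OnRung w d →
      Σ PrismColoring λ φ → rung φ u ≡ c × rung φ v ≡ c × rung φ w ≡ d
    solve-RRR-equal 2≤k {u} {v} {w} {c} {d} c≢d hu hv hw
      with b , b≢c , b≢d , _ ← fresh c d d
      with b′ , b′≢c , b′≢d , b′≢b ← fresh c d b
      = result forced , elsewhere hu (proj₁ avoids) , elsewhere hv (proj₂ avoids) , rung-at forced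
      where
      avoiding : Σ (AvoidingColoring c) λ F →
        (Adj w u → hue F w u ≢ d) × (Adj w v → hue F w v ≢ d)
      avoiding with u ≟ v
      -- The same rung may be listed twice, and then the entries with colours `b` and `b′` would not
      -- be coherent.
      ... | yes refl
        with F , wu ∷ [] ← extend (admissible₁ (w [ b ] u) (≤-trans (s≤s z≤n) 2≤k) b≢c)
        = let ≢d = λ a eq → b≢d (trans (≡.sym (wu (inj₁ (refl , refl)) a)) eq) in F , ≢d , ≢d
      ... | no u≢v
        -- The two colours other than `c` and `d` keep the edge exchanged at `w` away from both `u`
        -- and `v`.
        with F , wu ∷ wv ∷ [] ← extend (admissible₂ (w [ b ] u) (w [ b′ ] v) 2≤k b≢c b′≢c
               (coherent-distinct (≢-sym b′≢b)
                 [ u≢v ∘ ≡.sym ∘ proj₂ , (λ (w≡u , v≡w) → u≢v (≡.sym (trans v≡w w≡u))) ]))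
        = F , (λ a eq → b≢d (trans (≡.sym (wu (inj₁ (refl , refl)) a)) eq))
            , (λ a eq → b′≢d (trans (≡.sym (wv (inj₁ (refl , refl)) a)) eq))

      F : AvoidingColoring c
      F = proj₁ avoiding
      avoids = proj₂ avoiding

      forced : Forced (prism (λ _ → F)) c w d
      forced = force-flat F (≢-sym c≢d)

      elsewhere : ∀ {z} → OnRung z c → (Adj w z → hue F w z ≢ d) → rung (result forced) z ≡ c
      elsewhere hz free = rung-elsewhere forced (rung-unique hz hw c≢d) free

    -- The c-coloured edge at u is kept away from the rung at v by prescribing a fourth
    -- colour on uv.
    solve-RRC-force : 2 ≤ k → ∀ {u c v d i e} → c ≢ d → color e ≢ d →
      OnRung u c → OnRung v d → OnCopy i e →
      Σ PrismColoring λ φ → rung φ u ≡ c × rung φ v ≡ d × Agrees (copy φ i) e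
    solve-RRC-force 2≤k {u} {c} {v} {d} {i} {e} c≢d e≢d hu hv he =
      result forced , rung-at forced ,
      rung-elsewhere forced (rung-unique hv hu (≢-sym c≢d)) uv≢c ,
      agrees-forced forced i at at (rung-off {e = e} hu he)
      where
      avoiding : Σ (AvoidingColoring d) λ F → Agrees (hue F) e × (Adj u v → hue F u v ≢ c)
      avoiding with joins? e u v | fresh c d (color e)
      -- If `e` is `uv` itself, its colour is not `c`, because the rung at `u` is.
      ... | yes j | _
        with F , at ∷ [] ← extend (admissible₁ e (≤-trans (s≤s z≤n) 2≤k) e≢d)
        = F , at , λ uv eq → let u≢l , u≢r = rung-off {e = e} hu he (trans (≡.sym (at j uv)) eq)
                             in [ u≢l , u≢r ] (joins-end e j)
      ... | no ¬j | b , b≢c , b≢d , b≢e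
        with F , at ∷ uv ∷ [] ← extend (admissible₂ e (u [ b ] v) 2≤k e≢d b≢d
               (coherent-distinct (≢-sym b≢e) ¬j))
        = F , at , λ a eq → b≢c (trans (≡.sym (uv (inj₁ (refl , refl)) a)) eq)

      F : AvoidingColoring d
      F = proj₁ avoiding

      at : Agrees (hue F) e
      at = proj₁ (proj₂ avoiding)

      uv≢c : Adj u v → hue F u v ≢ c
      uv≢c = proj₂ (proj₂ avoiding)

      forced : Forced (prism (λ _ → F)) d u c
      forced = force-flat F c≢d

    solve-RRC : 2 ≤ k → ∀ {u c v d i e} → OnRung u c → OnRung v d → OnCopy i e →
      Σ PrismColoring λ φ → rung φ u ≡ c × rung φ v ≡ d × Agrees (copy φ i) e
    solve-RRC 2≤k {u} {c} {v} {d} {i} {e} hu hv he with c ≟ d | color e ≟ d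
    ... | yes refl | yes refl
      with φ , ag , r ← flat {e} {[]} z≤n ([] ∷ []) (onCopy-adj {e = e} he ∷ [])
      with at ∷ [] ← ag i =
        φ , r u (rung-off {e = e} hu he ∷ []) , r v (rung-off {e = e} hv he ∷ []) , at
    ... | yes refl | no e≢d
      with F , at ∷ [] ← extend (admissible₁ e (≤-trans (s≤s z≤n) 2≤k) e≢d)
      = prism (λ _ → F) , refl , refl , at
    ... | no c≢d | no e≢d = solve-RRC-force 2≤k {e = e} c≢d e≢d hu hv he
    -- The common rung colour must differ from that of `e`, so here it is `c` and the rung at `v` is
    -- forced.
    ... | no c≢d | yes refl
      with φ , rv , ru , at ← solve-RRC-force 2≤k {e = e} (≢-sym c≢d) (≢-sym c≢d) hv hu he
      = φ , ru , rv , at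

    -- Three prescribed edges leave a fourth colour for all rungs, and neither copy exceeds its
    -- budget.
    solve-CC-C : 2 ≤ k → ∀ {i e e′ l e″} → i ≢ l → OnCopy i e → OnCopy i e′ → OnCopy l e″ →
      Σ PrismColoring λ φ → Agrees (copy φ i) e × Agrees (copy φ i) e′ × Agrees (copy φ l) e″
    solve-CC-C 2≤k {i} {e} {e′} {l} {e″} i≢l h h′ h″
      with a , a≢ , a≢′ , a≢″ ← fresh (color e) (color e′) (color e″)
      with φ , at ∷ at′ ∷ [] , at″ ∷ [] , _ ← plain₂ i≢l
             (admissible₂ e e′ 2≤k (≢-sym a≢) (≢-sym a≢′) (onCopy-coherent {e = e} {e′} h h′))
             (admissible₁ e″ (≤-trans (s≤s z≤n) 2≤k) (≢-sym a≢″))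
      = φ , at , at′ , at″

    solve-CCC : 2 ≤ k → ∀ {i e j e′ l e″} → OnCopy i e → OnCopy j e′ → OnCopy l e″ →
      Σ PrismColoring λ φ → Agrees (copy φ i) e × Agrees (copy φ j) e′ × Agrees (copy φ l) e″
    solve-CCC 2≤k {i} {e} {j} {e′} {l} {e″} h h′ h″ with i ≟ j | i ≟ l
    ... | yes refl | yes refl
      with φ , ag , _ ← flat {e} {e′ ∷ e″ ∷ []} 2≤k
             ((onCopy-coherent {e = e} {e′} h h′ ∷ onCopy-coherent {e = e} {e″} h h″ ∷ [])
               ∷ (onCopy-coherent {e = e′} {e″} h′ h″ ∷ []) ∷ [] ∷ [])
             (onCopy-adj {e = e} h ∷ onCopy-adj {e = e′} h′ ∷ onCopy-adj {e = e″} h″ ∷ [])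
      with at ∷ at′ ∷ at″ ∷ [] ← ag i = φ , at , at′ , at″
    ... | yes refl | no i≢l = solve-CC-C 2≤k {e = e} {e′ = e′} {e″ = e″} i≢l h h′ h″
    ... | no i≢j | yes refl
      with φ , at , at″ , at′ ← solve-CC-C 2≤k {e = e} {e′ = e″} {e″ = e′} i≢j h h″ h′
      = φ , at , at′ , at″
    ... | no i≢j | no i≢l with two-copies i≢j l
    ...   | inj₁ refl = contradiction refl i≢l
    ...   | inj₂ refl
      with φ , at′ , at″ , at ← solve-CC-C 2≤k {e = e′} {e′ = e″} {e″ = e} (≢-sym i≢j) h′ h″ h
      = φ , at , at′ , at″

    -- One rung and two copy edges

    solve-RCC-parallel-missing : 2 ≤ k → ∀ {u x y c d i j} → c ≢ d → i ≢ j →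
      OnRung u c → OnCopy i (x [ c ] y) → OnCopy j (x [ d ] y) →
      (∀ {v} → Adj u v → v ≡ x ⊎ v ≡ y) → ¬ Adj u y →
      Σ PrismColoring λ φ →
        rung φ u ≡ c × Agrees (copy φ i) (x [ c ] y) × Agrees (copy φ j) (x [ d ] y)
    solve-RCC-parallel-missing 2≤k {u} {x} {y} {c} {d} {i} {j} c≢d i≢j hu h h′ nbrs ¬uy
      with a , a≢c , a≢d , _ ← fresh c d d
      with b , b≢c , b≢d , b≢a ← fresh c d a
      with u≢x , u≢y ← rung-off {e = x [ c ] y} hu h refl
      -- The only possible edge at `u` is `ux`. It avoids `c` in copy `i`, where `xy` has that
      -- colour, and in copy `j` by the auxiliary colour `b`.
      with φ , at ∷ [] , at′ ∷ ux ∷ [] , r ← plain₂ i≢j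
             (admissible₁ (x [ c ] y) (≤-trans (s≤s z≤n) 2≤k) (≢-sym a≢c))
             (admissible₂ (x [ d ] y) (u [ b ] x) 2≤k (≢-sym a≢d) b≢a
               (coherent-distinct (≢-sym b≢d) [ u≢x ∘ proj₁ , u≢y ∘ proj₁ ]))
      = result forced , rung-at forced
        , agrees-forced-off {e = x [ c ] y} forced i at (u≢x , u≢y)
        , agrees-forced-off {e = x [ d ] y} forced j at′ (u≢x , u≢y)
      where
      missing : ∀ l {v} → Adj u v → copy φ l u v ≢ c
      missing l uv eq with nbrs uv | two-copies i≢j l
      ... | inj₂ refl | _         = ¬uy uv
      ... | inj₁ refl | inj₁ refl =
        blocked φ i {e = x [ c ] y} at (onCopy-adj {e = x [ c ] y} h) (inj₁ (refl , refl)) u≢y uv eq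
      ... | inj₁ refl | inj₂ refl = b≢c (trans (≡.sym (ux (inj₁ (refl , refl)) uv)) eq)

      forced : Forced φ a u c
      forced = force-missing φ (≢-sym a≢c) (r u) missing

    -- Here uxy is a component of G: u cannot avoid c in the second copy, so the colours
    -- b and c of the two copies of uy are distributed over its 4-cycle.
    solve-RCC-parallel-triangle : 2 ≤ k → ∀ {u x y c d i j} → c ≢ d → i ≢ j →
      OnRung u c → OnCopy i (x [ c ] y) → OnCopy j (x [ d ] y) →
      (∀ {v} → Adj u v → v ≡ x ⊎ v ≡ y) → Adj u x → Adj u y →
      Σ PrismColoring λ φ →
        rung φ u ≡ c × Agrees (copy φ i) (x [ c ] y) × Agrees (copy φ j) (x [ d ] y)
    solve-RCC-parallel-triangle 2≤k {u} {x} {y} {c} {d} {i} {j} c≢d i≢j hu h h′ nbrs ux uy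
      with a , a≢c , a≢d , _ ← fresh c d d
      with b , b≢c , b≢d , b≢a ← fresh c d a
      with u≢x , u≢y ← rung-off {e = x [ c ] y} hu h refl
      -- Once `uy` has colour `a` in both copies, `c` is free at `u`: `ux` cannot have it, because
      -- of `xy` in copy `i` and because of the old `uy` in copy `j`.
      with φ , at ∷ uyᵢ ∷ [] , at′ ∷ uyⱼ ∷ [] , r ← plain₂ {a = a} i≢j
             (admissible₂ (x [ c ] y) (u [ b ] y) 2≤k (≢-sym a≢c) b≢a
               (coherent-distinct (≢-sym b≢c) [ u≢x ∘ proj₁ , u≢y ∘ proj₁ ]))
             (admissible₂ (x [ d ] y) (u [ c ] y) 2≤k (≢-sym a≢d) (≢-sym a≢c)
               (coherent-distinct (≢-sym c≢d) [ u≢x ∘ proj₁ , u≢y ∘ proj₁ ]))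
      = recolor , m-u
        , (λ t sv → trans (kept i (untouched {c} t)) (at t sv))
        , (λ t sv → trans (kept j (untouched {d} t)) (at′ t sv))
      where
      xy : Adj x y
      xy = onCopy-adj {e = x [ c ] y} h

      T : Fin n → Fin n → Set
      T = Joins (u [ a ] y)

      m : Fin n → Color
      m z with z ≟ u | z ≟ y
      ... | yes _ | _     = c
      ... | no _  | yes _ = b
      ... | no _  | no _  = a

      m-u : m u ≡ c
      m-u with u ≟ u
      ... | yes _  = refl
      ... | no u≢u = contradiction refl u≢u

      m≢a : ∀ {z v} → T z v → m z ≢ a
      m≢a {z} t with z ≟ u | z ≟ y
      ... | yes _  | _      = ≢-sym a≢c
      ... | no _   | yes _  = b≢a
      ... | no z≢u | no z≢y = ⊥-elim ([ z≢u , z≢y ] (joins-end (u [ a ] y) t))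

      m≢copy : ∀ l {z v} → Adj z v → ¬ T z v → copy φ l z v ≢ m z
      m≢copy l {z} {v} zv ¬t with z ≟ u | z ≟ y
      ... | no _ | no _ = λ eq → copy≢rung φ l zv (trans eq (≡.sym (r z)))
      ... | yes refl | _ with nbrs zv | two-copies i≢j l
      ...   | inj₂ refl | _         = contradiction (inj₁ (refl , refl)) ¬t
      ...   | inj₁ refl | inj₁ refl =
        blocked φ i {e = x [ c ] y} at xy (inj₁ (refl , refl)) u≢y zv
      ...   | inj₁ refl | inj₂ refl = λ eq → adj-irrefl (subst (Adj x)
        (copy-inj φ j uy ux (trans (uyⱼ (inj₁ (refl , refl)) uy) (≡.sym eq))) xy)
      m≢copy l {z} {v} zv ¬t | no _ | yes refl
        -- Apart from `uy`, the only edge at `y` is `xy`, coloured `c` or `d`; so its rung may take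
        -- `b`.
        with triangle-closed 2≤k (adj-sym xy) (adj-sym ux) uy zv | two-copies i≢j l
      ...   | inj₁ refl | _         = contradiction (inj₂ (refl , refl)) ¬t
      ...   | inj₂ refl | inj₁ refl = λ eq → b≢c (trans (≡.sym eq) (at (inj₂ (refl , refl)) zv))
      ...   | inj₂ refl | inj₂ refl = λ eq → b≢d (trans (≡.sym eq) (at′ (inj₂ (refl , refl)) zv))

      recoloring : Recoloring φ a
      recoloring = record
        { S = T ; S? = joins? (u [ a ] y) ; S-sym = joins-sym (u [ a ] y)
        ; S-match = joins-unique (u [ a ] y) ; S-rung = λ _ → r _
        ; m = m ; m≢a = m≢a ; m≢copy = m≢copy }

      open Recoloring recoloring

      untouched : ∀ {e s v} → Joins (x [ e ] y) s v → ¬ T s v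
      untouched (inj₁ (refl , _)) (inj₁ (x≡u , _))    = u≢x (≡.sym x≡u)
      untouched (inj₁ (_ , refl)) (inj₂ (_ , y≡u))    = u≢y (≡.sym y≡u)
      untouched (inj₂ (refl , _)) (inj₁ (y≡u , _))    = u≢y (≡.sym y≡u)
      untouched (inj₂ (_ , refl)) (inj₂ (_ , x≡u))    = u≢x (≡.sym x≡u)

    -- The copies disagree on `xy`, so `a` avoids `c` and `d` and the rung at `u` has to be forced.
    -- A neighbour of `u` other than `x` and `y` provides an edge that can be coloured `c` in both
    -- copies.
    solve-RCC-parallel : 2 ≤ k → ∀ {u x y c d i j} → c ≢ d → i ≢ j →
      OnRung u c → OnCopy i (x [ c ] y) → OnCopy j (x [ d ] y) →
      Σ PrismColoring λ φ →
        rung φ u ≡ c × Agrees (copy φ i) (x [ c ] y) × Agrees (copy φ j) (x [ d ] y)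
    solve-RCC-parallel 2≤k {u} {x} {y} {c} {d} {i} {j} c≢d i≢j hu h h′
      with other-neighbor? u x y
    ... | yes (w , uw , w≢x , w≢y)
      with a , a≢c , a≢d , _ ← fresh c d d
      with u≢x , u≢y ← rung-off {e = x [ c ] y} hu h refl
      with φ , at ∷ uwᵢ ∷ [] , at′ ∷ uwⱼ ∷ [] , r ← plain₂ i≢j
             (admissible₂ (x [ c ] y) (u [ c ] w) 2≤k (≢-sym a≢c) (≢-sym a≢c)
               (coherent-disjoint (≢-sym u≢x) (≢-sym w≢x) (≢-sym u≢y) (≢-sym w≢y)))
             (admissible₂ (x [ d ] y) (u [ c ] w) 2≤k (≢-sym a≢d) (≢-sym a≢c)
               (coherent-distinct (≢-sym c≢d) [ u≢x ∘ proj₁ , u≢y ∘ proj₁ ]))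
      = let forced = force-edge φ (≢-sym a≢c) r uw λ l →
              [ (λ { refl → uwᵢ (inj₁ (refl , refl)) uw })
              , (λ { refl → uwⱼ (inj₁ (refl , refl)) uw }) ] (two-copies i≢j l)
        in result forced , rung-at forced
           , agrees-forced-off {e = x [ c ] y} forced i at (u≢x , u≢y)
           , agrees-forced-off {e = x [ d ] y} forced j at′ (u≢x , u≢y)
    solve-RCC-parallel 2≤k {u} {x} {y} {c} {d} {i} {j} c≢d i≢j hu h h′ | no none
      with adj? u x | adj? u y
    ... | yes ux | yes uy =
      solve-RCC-parallel-triangle 2≤k c≢d i≢j hu h h′ (neighbor-in none) ux uy
    ... | _ | no ¬uy =
      solve-RCC-parallel-missing 2≤k c≢d i≢j hu h h′ (neighbor-in none) ¬uy
    ... | no ¬ux | yes _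
      with φ , ru , at , at′ ← solve-RCC-parallel-missing 2≤k c≢d i≢j hu
             (onCopy-join {e = x [ c ] y} h (inj₂ (refl , refl)))
             (onCopy-join {e = x [ d ] y} h′ (inj₂ (refl , refl)))
             ([ inj₂ , inj₁ ] ∘ neighbor-in none) ¬ux
      = φ , ru , agrees-join {e = x [ c ] y} (inj₂ (refl , refl)) at
               , agrees-join {e = x [ d ] y} (inj₂ (refl , refl)) at′

    -- No single colouring of `G` gives `c` to both `sx` and `sz`, so the copies differ. The rung at
    -- `u` is forced through an edge `uw` away from `s`, `x`, `z`, or else by keeping `c` from `u`.
    solve-RCC-meeting : 2 ≤ k → ∀ {u s x z c i j} → x ≢ z → i ≢ j →
      OnRung u c → OnCopy i (s [ c ] x) → OnCopy j (s [ c ] z) →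
      Σ PrismColoring λ φ →
        rung φ u ≡ c × Agrees (copy φ i) (s [ c ] x) × Agrees (copy φ j) (s [ c ] z)
    solve-RCC-meeting 2≤k {u} {s} {x} {z} {c} {i} {j} x≢z i≢j hu h h′
      with a , a≢c , _ ← fresh c c c
      with b , b≢c , _ , b≢a ← fresh c c a
      with u≢s , u≢x ← rung-off {e = s [ c ] x} hu h refl
      with _ , u≢z ← rung-off {e = s [ c ] z} hu h′ refl
      with any? (λ w → adj? u w ×-dec ¬? (w ≟ s) ×-dec ¬? (w ≟ x) ×-dec ¬? (w ≟ z))
    ... | yes (w , uw , w≢s , w≢x , w≢z)
      with φ , at ∷ uwᵢ ∷ [] , at′ ∷ uwⱼ ∷ [] , r ← plain₂ i≢j
             (admissible₂ (s [ c ] x) (u [ c ] w) 2≤k (≢-sym a≢c) (≢-sym a≢c)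
               (coherent-disjoint (≢-sym u≢s) (≢-sym w≢s) (≢-sym u≢x) (≢-sym w≢x)))
             (admissible₂ (s [ c ] z) (u [ c ] w) 2≤k (≢-sym a≢c) (≢-sym a≢c)
               (coherent-disjoint (≢-sym u≢s) (≢-sym w≢s) (≢-sym u≢z) (≢-sym w≢z)))
      = let forced = force-edge φ (≢-sym a≢c) r uw λ l →
              [ (λ { refl → uwᵢ (inj₁ (refl , refl)) uw })
              , (λ { refl → uwⱼ (inj₁ (refl , refl)) uw }) ] (two-copies i≢j l)
        in result forced , rung-at forced
           , agrees-forced-off {e = s [ c ] x} forced i at (u≢s , u≢x)
           , agrees-forced-off {e = s [ c ] z} forced j at′ (u≢s , u≢z)
    ... | no none
      -- In copy `i` the vertices `s` and `x` already meet `c`, so only `uz` needs another colour;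
      -- in copy `j` only `ux` does.
      with φ , at ∷ uz ∷ [] , at′ ∷ ux ∷ [] , r ← plain₂ i≢j
             (admissible₂ (s [ c ] x) (u [ b ] z) 2≤k (≢-sym a≢c) b≢a
               (coherent-distinct (≢-sym b≢c) [ u≢s ∘ proj₁ , u≢x ∘ proj₁ ]))
             (admissible₂ (s [ c ] z) (u [ b ] x) 2≤k (≢-sym a≢c) b≢a
               (coherent-distinct (≢-sym b≢c) [ u≢s ∘ proj₁ , u≢z ∘ proj₁ ]))
      = let forced = force-missing φ (≢-sym a≢c) (r u) missing
        in result forced , rung-at forced
           , agrees-forced-off {e = s [ c ] x} forced i at (u≢s , u≢x)
           , agrees-forced-off {e = s [ c ] z} forced j at′ (u≢s , u≢z)
      where
      missing : ∀ l {v} → Adj u v → copy φ l u v ≢ c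
      missing l {v} uv
        with v ≟ s | v ≟ x | v ≟ z | two-copies i≢j l
      ... | yes refl | _ | _ | inj₁ refl =
        blocked φ i {e = s [ c ] x} at (onCopy-adj {e = s [ c ] x} h) (inj₁ (refl , refl)) u≢x uv
      ... | yes refl | _ | _ | inj₂ refl =
        blocked φ j {e = s [ c ] z} at′ (onCopy-adj {e = s [ c ] z} h′) (inj₁ (refl , refl)) u≢z uv
      ... | no _ | yes refl | _ | inj₁ refl =
        blocked φ i {e = s [ c ] x} at (adj-sym (onCopy-adj {e = s [ c ] x} h))
          (inj₂ (refl , refl)) u≢s uv
      ... | no _ | yes refl | _ | inj₂ refl =
        λ eq → b≢c (trans (≡.sym (ux (inj₁ (refl , refl)) uv)) eq)
      ... | no _ | no _ | yes refl | inj₁ refl =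
        λ eq → b≢c (trans (≡.sym (uz (inj₁ (refl , refl)) uv)) eq)
      ... | no _ | no _ | yes refl | inj₂ refl =
        blocked φ j {e = s [ c ] z} at′ (adj-sym (onCopy-adj {e = s [ c ] z} h′))
          (inj₂ (refl , refl)) u≢s uv
      ... | no v≢s | no v≢x | no v≢z | _ = contradiction (v , uv , v≢s , v≢x , v≢z) none

    solve-RCC-flat : 2 ≤ k → ∀ {u i e j e′} → OnRung u (color e) → OnCopy i e → OnCopy j e′ →
      Coherent e e′ →
      Σ PrismColoring λ φ → rung φ u ≡ color e × Agrees (copy φ i) e × Agrees (copy φ j) e′
    solve-RCC-flat 2≤k {u} {i} {e} {j} {e′} hu h h′ coherent
      with φ , ag , r ← flat {e} {e′ ∷ []} (≤-trans (s≤s z≤n) 2≤k) ((coherent ∷ []) ∷ [] ∷ [])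
             (onCopy-adj {e = e} h ∷ onCopy-adj {e = e′} h′ ∷ [])
      with at ∷ _ ← ag i | _ ∷ at′ ∷ [] ← ag j
      = φ , r u (rung-off {e = e} hu h ∷ rung-off {e = e′} hu h′ ∷ []) , at , at′

    -- Entries of different colours clash only on one and the same edge of `G`, which then has its
    -- two colours in different copies.
    solve-RCC-one : 2 ≤ k → ∀ {u i e j e′} → color e ≢ color e′ →
      OnRung u (color e) → OnCopy i e → OnCopy j e′ →
      Σ PrismColoring λ φ → rung φ u ≡ color e × Agrees (copy φ i) e × Agrees (copy φ j) e′
    solve-RCC-one 2≤k {u} {i} {e} {j} {e′} c≢ hu h h′ with joins? e (left e′) (right e′)
    ... | no ¬same = solve-RCC-flat 2≤k {e = e} {e′ = e′} hu h h′ (coherent-distinct c≢ ¬same)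
    ... | yes same
      with φ , ru , at , at′ ← solve-RCC-parallel 2≤k c≢
             (λ { refl → c≢ (proj₂ (onCopy-coherent {e = e} {e′} h h′ same (joins-self e′)) refl) })
             hu (onCopy-join {e = e} h same) h′
      = φ , ru , agrees-join {e = e} same at , at′

    solve-RCC : 2 ≤ k → ∀ {u c i e j e′} → OnRung u c → OnCopy i e → OnCopy j e′ →
      Σ PrismColoring λ φ → rung φ u ≡ c × Agrees (copy φ i) e × Agrees (copy φ j) e′
    solve-RCC 2≤k {u} {c} {i} {e} {j} {e′} hu h h′ with color e ≟ c | color e′ ≟ c
    ... | yes refl | no c≢ = solve-RCC-one 2≤k {e = e} {e′ = e′} (≢-sym c≢) hu h h′
    ... | no c≢ | yes refl
      with φ , ru , at′ , at ← solve-RCC-one 2≤k {e = e′} {e′ = e} (≢-sym c≢) hu h′ h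
      = φ , ru , at , at′
    solve-RCC 2≤k {u} {c} {i} {e} {j} {e′} hu h h′ | yes refl | yes eq with i ≟ j
    ... | yes refl =
      solve-RCC-flat 2≤k {e = e} {e′ = e′} hu h h′ (onCopy-coherent {e = e} {e′} h h′)
    ... | no i≢j with coherent-or-meet e e′ (≡.sym eq)
    ...   | inj₁ coherent = solve-RCC-flat 2≤k {e = e} {e′ = e′} hu h h′ coherent
    ...   | inj₂ (s , x , z , sx , sz , x≢z)
      with φ , ru , at , at′ ← solve-RCC-meeting 2≤k x≢z i≢j hu (onCopy-join {e = e} h sx)
             (subst (λ c → OnCopy j (s [ c ] z)) eq (onCopy-join {e = e′} h′ sz))
      = φ , ru , agrees-join {e = e} sx at
        , agrees-join {e = e′} sz (subst (λ c → Agrees (copy φ j) (s [ c ] z)) (≡.sym eq) at′)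
    -- Neither edge has the colour of the rung, so `c` serves for all rungs without any exchange.
    solve-RCC 2≤k {u} {c} {i} {e} {j} {e′} hu h h′ | no c≢ | no c≢′ with i ≟ j
    ... | yes refl
      with F , at ∷ at′ ∷ [] ← extend
             (admissible₂ e e′ 2≤k c≢ c≢′ (onCopy-coherent {e = e} {e′} h h′))
      = prism (λ _ → F) , refl , at , at′
    ... | no i≢j
      with φ , at ∷ [] , at′ ∷ [] , r ← plain₂ i≢j (admissible₁ e (≤-trans (s≤s z≤n) 2≤k) c≢)
             (admissible₁ e′ (≤-trans (s≤s z≤n) 2≤k) c≢′)
      = φ , r u , at , at′

    -- Three rungs of distinct colours

    solve-RRR-private : 2 ≤ k → ∀ {u v z x y c d e} → c ≢ d → c ≢ e → d ≢ e → x ≢ y →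
      OnRung u c → OnRung v d → OnRung z e →
      Adj u x → x ≢ v → x ≢ z → Adj v y → y ≢ u → y ≢ z →
      Σ PrismColoring λ φ → rung φ u ≡ c × rung φ v ≡ d × rung φ z ≡ e
    solve-RRR-private 2≤k {u} {v} {z} {x} {y} {c} {d} {e} c≢d c≢e d≢e x≢y
      hu hv hz ux x≢v x≢z vy y≢u y≢z
      -- The exchanged edges will be `ux` and `vy`, which are disjoint and miss `z`.
      with F , at-ux ∷ at-vy ∷ [] ← extend (admissible₂ (u [ c ] x) (v [ d ] y) 2≤k c≢e d≢e
             (coherent-distinct c≢d
               [ rung-unique hv hu (≢-sym c≢d) ∘ proj₁ , x≢v ∘ ≡.sym ∘ proj₁ ]))
      = force-two F c≢e d≢e c≢d (rung-unique hu hv c≢d)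
          (rung-unique hz hu (≢-sym c≢e)) (rung-unique hz hv (≢-sym d≢e))
          (λ uv → (λ eq → x≢v (to-x uv eq))
                , (λ eq → y≢u (to-y (adj-sym uv) (trans (hue-sym F (adj-sym uv)) eq))))
          (λ uw vw cw dw → x≢y (trans (to-x uw cw) (≡.sym (to-y vw dw))))
          (λ uz eq → x≢z (to-x uz eq)) (λ vz eq → y≢z (to-y vz eq))
      where
      to-x : ∀ {w} → Adj u w → hue F u w ≡ c → x ≡ w
      to-x uw eq = hue-inj F ux uw (trans (at-ux (inj₁ (refl , refl)) ux) (≡.sym eq))
      to-y : ∀ {w} → Adj v w → hue F v w ≡ d → y ≡ w
      to-y vw eq = hue-inj F vy vw (trans (at-vy (inj₁ (refl , refl)) vy) (≡.sym eq))

    -- The exchange at `u` uses the rung at `x`, so `b` on `vx` sends the exchange at `v` elsewhere.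
    -- The two auxiliary colours also leave only `d` for `xz`, which keeps `d` off `vz`.
    solve-RRR-shared : 2 ≤ k → ∀ {u v z x c d e} → c ≢ d → c ≢ e → d ≢ e →
      OnRung u c → OnRung v d → OnRung z e →
      Adj u x → Adj v x → Adj z x → ¬ Adj u v →
      Σ PrismColoring λ φ → rung φ u ≡ c × rung φ v ≡ d × rung φ z ≡ e
    solve-RRR-shared 2≤k {u} {v} {z} {x} {c} {d} {e} c≢d c≢e d≢e hu hv hz ux vx zx ¬uv
      with b , b≢c , b≢d , b≢e ← fresh c d e
      with F , at-ux ∷ at-vx ∷ [] ← extend (admissible₂ (u [ c ] x) (v [ b ] x) 2≤k c≢e b≢e
             (coherent-distinct (≢-sym b≢c)
               [ rung-unique hv hu (≢-sym c≢d) ∘ proj₁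
               , (λ { (refl , _) → adj-irrefl vx }) ]))
      = force-two F c≢e d≢e c≢d (rung-unique hu hv c≢d) z≢u z≢v
          (λ uv → contradiction uv ¬uv)
          (λ { uw vw cw dw → v-at-x vx (subst (λ w → hue F v w ≡ d) (to-x uw cw) dw) })
          (λ uz eq → z≢x (to-x uz eq)) vz≢d
      where
      z≢u : z ≢ u
      z≢u = rung-unique hz hu (≢-sym c≢e)
      z≢v : z ≢ v
      z≢v = rung-unique hz hv (≢-sym d≢e)
      z≢x : z ≢ x
      z≢x refl = adj-irrefl zx
      to-x : ∀ {w} → Adj u w → hue F u w ≡ c → w ≡ x
      to-x uw eq = hue-inj F uw ux (trans eq (≡.sym (at-ux (inj₁ (refl , refl)) ux)))
      v-at-x : Adj v x → hue F v x ≢ d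
      v-at-x _ eq = b≢d (trans (≡.sym (at-vx (inj₁ (refl , refl)) vx)) eq)
      -- Otherwise no colour is left for xz.
      vz≢d : Adj v z → hue F v z ≢ d
      vz≢d vz eq = no-five-colors b c d e (hue F x z) b≢c b≢d b≢e c≢d c≢e d≢e
        (λ h → z≢v (hue-inj F (adj-sym zx) (adj-sym vx)
          (trans h (≡.sym (at-vx (inj₂ (refl , refl)) (adj-sym vx))))))
        (λ h → z≢u (hue-inj F (adj-sym zx) (adj-sym ux)
          (trans h (≡.sym (at-ux (inj₂ (refl , refl)) (adj-sym ux))))))
        (λ h → adj-irrefl (subst (λ w → Adj w x) (hue-inj F (adj-sym vz) zx
          (trans (hue-sym F (adj-sym vz)) (trans eq
            (trans (≡.sym h) (hue-sym F (adj-sym zx)))))) vx))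
        (hue≢ F (adj-sym zx))

    solve-RRR-isolated : 2 ≤ k → ∀ {u v z c d e} → c ≢ d → c ≢ e → d ≢ e →
      OnRung u c → OnRung v d → OnRung z e → (∀ {w} → Adj u w → w ≡ v ⊎ w ≡ z) →
      Σ PrismColoring λ φ → rung φ u ≡ c × rung φ v ≡ d × rung φ z ≡ e
    solve-RRR-isolated 2≤k {u} {v} {z} {c} {d} {e} c≢d c≢e d≢e hu hv hz nbrs
      with fresh c d e | adj? u z
    ... | b , b≢c , b≢d , b≢e | yes uz
      -- These are the only possible edges at `u`, so `c` is missing there; and `d` on `uz` excludes
      -- `d` on `vz`.
      with F , at-uz ∷ at-uv ∷ [] ← extend (admissible₂ (u [ d ] z) (u [ b ] v) 2≤k d≢e b≢e
             (coherent-distinct (≢-sym b≢d)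
               [ rung-unique hv hz d≢e ∘ proj₂ , rung-unique hu hz c≢e ∘ proj₁ ]))
      = force-two F c≢e d≢e c≢d (rung-unique hu hv c≢d)
          (rung-unique hz hu (≢-sym c≢e)) (rung-unique hz hv (≢-sym d≢e))
          (λ uv → (λ eq → b≢c (trans (≡.sym (at-uv (inj₁ (refl , refl)) uv)) eq))
                , (λ eq → b≢d (trans (≡.sym (at-uv (inj₁ (refl , refl)) uv)) eq)))
          (λ uw vw eq → ⊥-elim (missing uw eq)) missing
          (λ vz eq → rung-unique hu hv c≢d (hue-inj F (adj-sym uz) (adj-sym vz)
            (trans (at-uz (inj₂ (refl , refl)) (adj-sym uz))
              (trans (≡.sym eq) (hue-sym F vz)))))
      where
      missing : ∀ {w} → Adj u w → hue F u w ≢ c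
      missing uw eq with nbrs uw
      ... | inj₁ refl = b≢c (trans (≡.sym (at-uv (inj₁ (refl , refl)) uw)) eq)
      ... | inj₂ refl = c≢d (trans (≡.sym eq) (at-uz (inj₁ (refl , refl)) uw))
    solve-RRR-isolated 2≤k {u} {v} {z} {c} {d} {e} c≢d c≢e d≢e hu hv hz nbrs
      | b , b≢c , b≢d , b≢e | no ¬uz
      -- Only `v` can be adjacent to `u`. Here `b` keeps both exchanges off `uv`, and `c` keeps `d`
      -- off `vz`.
      with F , at-vu ∷ at-vz ∷ [] ← extend (admissible₂ (v [ b ] u) (v [ c ] z) 2≤k b≢e c≢e
             (coherent-distinct b≢c
               [ rung-unique hz hu (≢-sym c≢e) ∘ proj₂ , rung-unique hv hu (≢-sym c≢d) ∘ proj₁ ]))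
      = force-two F c≢e d≢e c≢d (rung-unique hu hv c≢d)
          (rung-unique hz hu (≢-sym c≢e)) (rung-unique hz hv (≢-sym d≢e))
          (λ uv → (λ eq → b≢c (trans (≡.sym (at-vu (inj₂ (refl , refl)) uv)) eq))
                , (λ eq → b≢d (trans (≡.sym (at-vu (inj₂ (refl , refl)) uv)) eq)))
          (λ { uw vw eq → ⊥-elim (loop (nbrs uw) uw vw) }) (λ uz → contradiction uz ¬uz)
          (λ vz eq → c≢d (trans (≡.sym (at-vz (inj₁ (refl , refl)) vz)) eq))
      where
      loop : ∀ {w} → w ≡ v ⊎ w ≡ z → Adj u w → ¬ Adj v w
      loop (inj₁ refl) _  vv = adj-irrefl vv
      loop (inj₂ refl) uz _  = ¬uz uz

    -- Pairwise adjacent, the three vertices would form a complete graph with `x`, contrary to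
    -- `triangle-closed`. By symmetry any non-adjacent pair can be the one that is forced.
    solve-RRR-common : 2 ≤ k → ∀ {u v z x c d e} → c ≢ d → c ≢ e → d ≢ e →
      OnRung u c → OnRung v d → OnRung z e →
      Adj u x → x ≢ v → x ≢ z → Adj v x → Adj z x →
      Σ PrismColoring λ φ → rung φ u ≡ c × rung φ v ≡ d × rung φ z ≡ e
    solve-RRR-common 2≤k {u} {v} {z} c≢d c≢e d≢e hu hv hz ux x≢v x≢z vx zx
      with adj? u v | adj? u z | adj? v z
    ... | no ¬uv | _ | _ = solve-RRR-shared 2≤k c≢d c≢e d≢e hu hv hz ux vx zx ¬uv
    ... | _ | no ¬uz | _
      with φ , ru , rz , rv ← solve-RRR-shared 2≤k c≢e c≢d (≢-sym d≢e) hu hz hv ux zx vx ¬uz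
      = φ , ru , rv , rz
    ... | _ | _ | no ¬vz
      with φ , rv , rz , ru ← solve-RRR-shared 2≤k d≢e (≢-sym c≢d) (≢-sym c≢e) hv hz hu vx zx ux ¬vz
      = φ , ru , rv , rz
    ... | yes uv | yes uz | yes vz =
      ⊥-elim ([ x≢z , x≢v ] (triangle-closed 2≤k {u} {v} {z} uv vz (adj-sym uz) ux))

    -- Any of the three colours can be the common rung colour, so one pair of different outside
    -- neighbours suffices; failing that, all three coincide.
    solve-RRR-free : 2 ≤ k → ∀ {u v z c d e} → c ≢ d → c ≢ e → d ≢ e →
      OnRung u c → OnRung v d → OnRung z e →
      (∃ λ w → Adj u w × w ≢ v × w ≢ z) → (∃ λ w → Adj v w × w ≢ u × w ≢ z) →
      (∃ λ w → Adj z w × w ≢ u × w ≢ v) →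
      Σ PrismColoring λ φ → rung φ u ≡ c × rung φ v ≡ d × rung φ z ≡ e
    solve-RRR-free 2≤k c≢d c≢e d≢e hu hv hz
      (x , ux , x≢v , x≢z) (y , vy , y≢u , y≢z) (w , zw , w≢u , w≢v) with x ≟ y | x ≟ w
    ... | no x≢y | _ =
      solve-RRR-private 2≤k c≢d c≢e d≢e x≢y hu hv hz ux x≢v x≢z vy y≢u y≢z
    ... | yes _ | no x≢w
      with φ , ru , rz , rv ← solve-RRR-private 2≤k c≢e c≢d (≢-sym d≢e) x≢w hu hz hv
             ux x≢z x≢v zw w≢u w≢v
      = φ , ru , rv , rz
    ... | yes refl | yes refl = solve-RRR-common 2≤k c≢d c≢e d≢e hu hv hz ux x≢v x≢z vy zw

    solve-RRR-distinct : 2 ≤ k → ∀ {u v z c d e} → c ≢ d → c ≢ e → d ≢ e →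
      OnRung u c → OnRung v d → OnRung z e →
      Σ PrismColoring λ φ → rung φ u ≡ c × rung φ v ≡ d × rung φ z ≡ e
    solve-RRR-distinct 2≤k {u} {v} {z} c≢d c≢e d≢e hu hv hz
      with other-neighbor? u v z | other-neighbor? v u z | other-neighbor? z u v
    ... | no none | _ | _ = solve-RRR-isolated 2≤k c≢d c≢e d≢e hu hv hz (neighbor-in none)
    ... | _ | no none | _
      with φ , rv , ru , rz ← solve-RRR-isolated 2≤k (≢-sym c≢d) d≢e c≢e hv hu hz (neighbor-in none)
      = φ , ru , rv , rz
    ... | _ | _ | no none
      with φ , rz , ru , rv ← solve-RRR-isolated 2≤k (≢-sym c≢e) (≢-sym d≢e) c≢d hz hu hv
             (neighbor-in none)
      = φ , ru , rv , rz
    ... | yes at-u | yes at-v | yes at-z =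
      solve-RRR-free 2≤k c≢d c≢e d≢e hu hv hz at-u at-v at-z

    solve-RRR : 2 ≤ k → ∀ {u v z c d e} → OnRung u c → OnRung v d → OnRung z e →
      Σ PrismColoring λ φ → rung φ u ≡ c × rung φ v ≡ d × rung φ z ≡ e
    solve-RRR 2≤k {u} {v} {z} {c} {d} {e} hu hv hz with c ≟ d | c ≟ e | d ≟ e
    ... | yes refl | yes refl | _ with φ , r ← plain-R c = φ , r u , r v , r z
    ... | yes refl | no c≢e | _ = solve-RRR-equal 2≤k c≢e hu hv hz
    ... | no c≢d | yes refl | _
      with φ , ru , rz , rv ← solve-RRR-equal 2≤k c≢d hu hz hv = φ , ru , rv , rz
    ... | no c≢d | no _ | yes refl
      with φ , rv , rz , ru ← solve-RRR-equal 2≤k (≢-sym c≢d) hv hz hu = φ , ru , rv , rz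
    ... | no c≢d | no c≢e | no d≢e = solve-RRR-distinct 2≤k c≢d c≢e d≢e hu hv hz

    -- Assembling the extension of the partial colouring

    data Constraint : Set where
      onRung : Fin n → Color → Constraint
      onCopy : Fin 2 → Entry n 4 → Constraint

    Prescribes : Constraint → Set
    Prescribes (onRung u c) = OnRung u c
    Prescribes (onCopy i e) = OnCopy i e

    Satisfies : PrismColoring → Constraint → Set
    Satisfies φ (onRung u c) = rung φ u ≡ c
    Satisfies φ (onCopy i e) = Agrees (copy φ i) e

    solve₁ : ∀ I → Prescribes I → Σ PrismColoring λ φ → Satisfies φ I
    solve₁ (onRung u c) _ with φ , r ← plain-R c = φ , r u
    solve₁ (onCopy i e) h = solve-C {e = e} h

    solve₂ : 1 ≤ k → ∀ I J → Prescribes I → Prescribes J →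
      Σ PrismColoring λ φ → Satisfies φ I × Satisfies φ J
    solve₂ 1≤k (onRung _ _) (onRung _ _) h h′ = solve-RR 1≤k h h′
    solve₂ 1≤k (onRung _ _) (onCopy _ e) h h′ = solve-RC 1≤k {e = e} h h′
    solve₂ 1≤k (onCopy _ e) (onRung _ _) h h′
      with φ , r , at ← solve-RC 1≤k {e = e} h′ h = φ , at , r
    solve₂ 1≤k (onCopy _ e) (onCopy _ e′) h h′ = solve-CC 1≤k {e = e} {e′ = e′} h h′

    solve₃ : 2 ≤ k → ∀ I J K → Prescribes I → Prescribes J → Prescribes K →
      Σ PrismColoring λ φ → Satisfies φ I × Satisfies φ J × Satisfies φ K
    solve₃ 2≤k (onRung _ _) (onRung _ _) (onRung _ _) h h′ h″ = solve-RRR 2≤k h h′ h″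
    solve₃ 2≤k (onRung _ _) (onRung _ _) (onCopy _ e) h h′ h″ = solve-RRC 2≤k {e = e} h h′ h″
    solve₃ 2≤k (onRung _ _) (onCopy _ e) (onRung _ _) h h′ h″
      with φ , r , r″ , at′ ← solve-RRC 2≤k {e = e} h h″ h′ = φ , r , at′ , r″
    solve₃ 2≤k (onCopy _ e) (onRung _ _) (onRung _ _) h h′ h″
      with φ , r′ , r″ , at ← solve-RRC 2≤k {e = e} h′ h″ h = φ , at , r′ , r″
    solve₃ 2≤k (onRung _ _) (onCopy _ e) (onCopy _ e′) h h′ h″ =
      solve-RCC 2≤k {e = e} {e′ = e′} h h′ h″
    solve₃ 2≤k (onCopy _ e) (onRung _ _) (onCopy _ e′) h h′ h″
      with φ , r , at , at″ ← solve-RCC 2≤k {e = e} {e′ = e′} h′ h h″ = φ , at , r , at″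
    solve₃ 2≤k (onCopy _ e) (onCopy _ e′) (onRung _ _) h h′ h″
      with φ , r , at , at′ ← solve-RCC 2≤k {e = e} {e′ = e′} h″ h h′ = φ , at , at′ , r
    solve₃ 2≤k (onCopy _ e) (onCopy _ e′) (onCopy _ e″) h h′ h″ =
      solve-CCC 2≤k {e = e} {e′ = e′} {e″ = e″} h h′ h″

    -- The length bound supplies `1 ≤ k` or `2 ≤ k`, just the budget that the cases consume, and
    -- `k < 3` excludes a fourth constraint.
    solve : ∀ Is → All Prescribes Is → length Is ≤ suc k → k < 3 →
      Σ PrismColoring λ φ → All (Satisfies φ) Is
    solve [] [] _ _ = proj₁ (plain-R zero) , []
    solve (I ∷ []) (h ∷ []) _ _ with φ , s ← solve₁ I h = φ , s ∷ []
    solve (I ∷ J ∷ []) (h ∷ h′ ∷ []) (s≤s 1≤k) _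
      with φ , s , s′ ← solve₂ 1≤k I J h h′ = φ , s ∷ s′ ∷ []
    solve (I ∷ J ∷ K ∷ []) (h ∷ h′ ∷ h″ ∷ []) (s≤s 2≤k) _
      with φ , s , s′ , s″ ← solve₃ 2≤k I J K h h′ h″ = φ , s ∷ s′ ∷ s″ ∷ []
    solve (_ ∷ _ ∷ _ ∷ _ ∷ _) _ size k<3
      with s≤s (s≤s (s≤s ())) ← ≤-trans size k<3

    pairColor : PrismColoring → Fin n × Fin 2 → Fin n × Fin 2 → Color
    pairColor φ (u , i) (v , j) = if does (i ≟ j) then copy φ i u v else rung φ u

    assemble : PrismColoring → ProperEdgeColoring (G □K₂) 4
    assemble φ = record
      { col = λ U V → pairColor φ (remQuot 2 U) (remQuot 2 V)
      ; symm = λ U V → pair-sym (remQuot 2 U) (remQuot 2 V)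
      ; proper = λ U V W UV UW V≢W eq → V≢W (trans (≡.sym (combine-remQuot {n} 2 V))
          (trans (cong (λ (v , i) → combine v i)
                   (pair-inj (remQuot 2 U) (remQuot 2 V) (remQuot 2 W) UV UW eq))
                 (combine-remQuot {n} 2 W))) }
      where
      pair-sym : ∀ U V → pairAdj G U V ≡ true → pairColor φ U V ≡ pairColor φ V U
      pair-sym (u , i) (v , j) adj with pairAdj-cases {u} {v} {i} {j} adj | i ≟ j | j ≟ i
      ... | inj₁ (refl , _)   | no _     | no _    = refl
      ... | inj₁ (_ , i≢j)    | yes i≡j  | _       = contradiction i≡j i≢j
      ... | inj₁ (_ , i≢j)    | _        | yes j≡i = contradiction (≡.sym j≡i) i≢j
      ... | inj₂ (i≡j , _)    | no i≢j   | _       = contradiction i≡j i≢j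
      ... | inj₂ (i≡j , _)    | _        | no j≢i  = contradiction (≡.sym i≡j) j≢i
      ... | inj₂ (_ , uv)     | yes refl | yes _   = copy-sym φ i uv

      pair-inj : ∀ U V W → pairAdj G U V ≡ true → pairAdj G U W ≡ true →
        pairColor φ U V ≡ pairColor φ U W → V ≡ W
      pair-inj (u , i) (v , j) (w , l) UV UW eq
        with pairAdj-cases {u} {v} {i} {j} UV | pairAdj-cases {u} {w} {i} {l} UW | i ≟ j | i ≟ l
      ... | inj₁ (refl , i≢j) | inj₁ (refl , i≢l) | _ | _
        with two-copies i≢j l
      ...   | inj₁ l≡i  = contradiction (≡.sym l≡i) i≢l
      ...   | inj₂ refl = refl
      pair-inj (u , i) _ _ _ _ eq
        | inj₂ (_ , uv) | inj₂ (_ , uw) | yes refl | yes refl = cong (_, i) (copy-inj φ i uv uw eq)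
      pair-inj (u , i) _ _ _ _ eq
        | inj₁ _ | inj₂ (_ , uw) | no _ | yes refl = ⊥-elim (copy≢rung φ i uw (≡.sym eq))
      pair-inj (u , i) _ _ _ _ eq
        | inj₂ (_ , uv) | inj₁ _ | yes refl | no _ = ⊥-elim (copy≢rung φ i uv eq)
      pair-inj _ _ _ _ _ _ | inj₁ (_ , i≢j) | _ | yes i≡j | _ = contradiction i≡j i≢j
      pair-inj _ _ _ _ _ _ | inj₂ (i≡j , _) | _ | no i≢j | _  = contradiction i≡j i≢j
      pair-inj _ _ _ _ _ _ | _ | inj₁ (_ , i≢l) | _ | yes i≡l = contradiction i≡l i≢l
      pair-inj _ _ _ _ _ _ | _ | inj₂ (i≡l , _) | _ | no i≢l  = contradiction i≡l i≢l

    assemble-combine : ∀ φ x i y j →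
      col (assemble φ) (combine x i) (combine y j) ≡ pairColor φ (x , i) (y , j)
    assemble-combine φ x i y j = cong₂ (pairColor φ) (remQuot-combine x i) (remQuot-combine y j)

    assemble-copy : ∀ φ i x y → col (assemble φ) (combine x i) (combine y i) ≡ copy φ i x y
    assemble-copy φ i x y = trans (assemble-combine φ x i y i)
      (cong (if_then copy φ i x y else rung φ x) (dec-true (i ≟ i) refl))

    assemble-rung : ∀ φ {i j} x y → i ≢ j →
      col (assemble φ) (combine x i) (combine y j) ≡ rung φ x
    assemble-rung φ {i} {j} x y i≢j = trans (assemble-combine φ x i y j)
      (cong (if_then copy φ i x y else rung φ x) (dec-false (i ≟ j) i≢j))

    Enforces : Constraint → Fin (n * 2) → Fin (n * 2) → Color → Set
    Enforces I U V c = ∀ φ → Satisfies φ I → col (assemble φ) U V ≡ c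

    constraint-combine : ∀ x i y j {c} → pcol p (combine x i) (combine y j) ≡ just c →
      Σ Constraint λ I → Prescribes I × Enforces I (combine x i) (combine y j) c
    constraint-combine x i y j {c} eq with colored-cases {x} {i} {y} {j} eq
    ... | inj₂ (refl , xy) = onCopy i (x [ c ] y) , eq ,
      λ φ ag → trans (assemble-copy φ i x y) (ag (inj₁ (refl , refl)) xy)
    ... | inj₁ (refl , i≢j) = onRung x c , upright i j i≢j eq ,
      λ φ r → trans (assemble-rung φ x y i≢j) r
      where
      upright : ∀ i j → i ≢ j → pcol p (combine x i) (combine x j) ≡ just c → OnRung x c
      upright zero       zero       i≢j _ = contradiction refl i≢j
      upright zero       (suc zero) _ h   = h
      upright (suc zero) zero       _ h   = trans (psymm p _ _) h
      upright (suc zero) (suc zero) i≢j _ = contradiction refl i≢j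

    constraint : ∀ U V {c} → pcol p U V ≡ just c →
      Σ Constraint λ I → Prescribes I × Enforces I U V c
    constraint U V {c} = subst₂
      (λ U V → pcol p U V ≡ just c → Σ Constraint λ I → Prescribes I × Enforces I U V c)
      (combine-remQuot {n} 2 U) (combine-remQuot {n} 2 V)
      (constraint-combine (proj₁ (remQuot {n} 2 U)) (proj₂ (remQuot {n} 2 U))
                          (proj₁ (remQuot {n} 2 V)) (proj₂ (remQuot {n} 2 V)))

    constraints : ∀ L → Σ (List Constraint) λ Is → length Is ≤ length L × All Prescribes Is ×
      (∀ φ → All (Satisfies φ) Is → ∀ {U V c} → (U , V) ∈ L → pcol p U V ≡ just c →
        col (assemble φ) U V ≡ c)
    constraints [] = [] , z≤n , [] , λ _ _ ()
    constraints ((U , V) ∷ L) with constraints L | pcol p U V in eq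
    -- The list may contain pairs that `p` leaves uncoloured; they yield no constraint.
    ... | Is , size , hs , enforce | nothing = Is , m≤n⇒m≤1+n size , hs ,
      λ { φ ss (here refl) eq′ → contradiction (trans (≡.sym eq) eq′) λ ()
        ; φ ss (there m) eq′ → enforce φ ss m eq′ }
    ... | Is , size , hs , enforce | just c with I , h , f ← constraint U V eq =
      I ∷ Is , s≤s size , h ∷ hs ,
      λ { φ (s ∷ _) (here refl) eq′ → trans (f φ s) (just-injective (trans (≡.sym eq) eq′))
        ; φ (_ ∷ ss) (there m) eq′ → enforce φ ss m eq′ }

    extendable : k < 3 → ColorsAtMost p (suc k) → Extendable p
    extendable k<3 (L , size , covers)
      with Is , size′ , hs , enforce ← constraints L
      with φ , ss ← solve Is hs (≤-trans size′ size) k<3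
      = assemble φ , agree
      where
      agree : ∀ U V c → pcol p U V ≡ just c → col (assemble φ) U V ≡ c
      agree U V c eq with covers U V c eq
      ... | inj₁ m = enforce φ ss m eq
      ... | inj₂ m = trans (symm (assemble φ) U V (onEdges p U V c eq))
                           (enforce φ ss m (trans (psymm p V U) eq))

theorem4p5 : ∀ {n} (G : Graph n) (k : ℕ) →
    MaxDegree G 3 → ChromaticIndex G 3 → k < 3 →
    (∀ (p : PartialEdgeColoring G 3) → ColorsAtMost p k → Extendable p) →
    ∀ (p : PartialEdgeColoring (G □K₂) 4) → ColorsAtMost p (suc k) → Extendable p
theorem4p5 G k _ _ k<3 ext p = Extension.Prescribed.extendable G k ext p k<3
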